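{- Let $G$ be a graph with $n$ vertices, maximum degree $\Delta$ and minimum degree $\delta$, and let $\overline{G}$ be its complement. If $0\leq \alpha \leq 1$ and $1\leq k\leq n$, then $$(1-\alpha)n+(\alpha n-1)k \leq S_{k}(A_{\alpha}(G))+S_{k}(A_{\alpha}(\overline{G}))\leq k\left[(2-\alpha)n+\alpha(\Delta-\delta-1)-(1-\alpha)(k+1)\right].$$
   Context: All graphs are simple and undirected. $A_{\alpha}(G)=\alpha D(G)+(1-\alpha)A(G)$, where $A(G)$ is the adjacency matrix and $D(G)$ the diagonal degree matrix. For a real symmetric matrix $M$ with eigenvalues $\lambda_1(M)\geq\cdots\geq\lambda_n(M)$, $S_k(M)=\sum_{i=1}^k\lambda_i(M)$. -}

module Defs where

open import Level using (Level; _⊔_) renaming (suc to lsuc)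
open import Algebra.Apartness.Bundles using (HeytingField)
open import Algebra.Bundles using (CommutativeRing; Semiring)
open import Data.Bool.Base using (Bool; true; false; not; _∧_; if_then_else_)
open import Data.Fin.Base as Fin using (Fin; zero; suc; toℕ; punchIn; inject≤)
open import Data.Fin.Properties using (_≟_)
open import Data.Fin.Subset using (Subset; ∣_∣)
open import Data.Nat.Base as ℕ using (ℕ; zero; suc)
open import Data.Product.Base using (∃-syntax; _×_)
open import Data.Sum.Base using (_⊎_)
open import Data.Vec.Base using (tabulate)
open import Data.Vec.Functional using (Vector)
open import Relation.Binary.Core using (Rel)
open import Relation.Binary.PropositionalEquality
  using (_≡_; refl; sym; cong; cong₂)
open import Relation.Binary.Structures using (IsStrictPartialOrder)
open import Relation.Nullary using (¬_; yes; no; ⌊_⌋; contradiction)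

private
  variable
    n : ℕ

------------------------------------------------------------------------
-- Simple undirected graphs

record Graph (n : ℕ) : Set where
  field
    adj        : Fin n → Fin n → Bool
    adj-sym    : ∀ i j → adj i j ≡ adj j i
    adj-irrefl : ∀ i → adj i i ≡ false

open Graph public

≟-flip : (i j : Fin n) → ⌊ i ≟ j ⌋ ≡ ⌊ j ≟ i ⌋
≟-flip i j with i ≟ j | j ≟ i
... | yes _   | yes _   = refl
... | no _    | no _    = refl
... | yes i≡j | no j≢i  = contradiction (sym i≡j) j≢i
... | no i≢j  | yes j≡i = contradiction (sym j≡i) i≢j

∧-not-≟-irrefl : (b : Bool) (i : Fin n) → b ∧ not ⌊ i ≟ i ⌋ ≡ false
∧-not-≟-irrefl false i = refl
∧-not-≟-irrefl true  i with i ≟ i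
... | yes _   = refl
... | no  i≢i = contradiction refl i≢i

complement : Graph n → Graph n
complement G = record
  { adj        = λ i j → not (adj G i j) ∧ not ⌊ i ≟ j ⌋
  ; adj-sym    = λ i j → cong₂ _∧_ (cong not (adj-sym G i j)) (cong not (≟-flip i j))
  ; adj-irrefl = λ i → ∧-not-≟-irrefl (not (adj G i i)) i
  }

neighbours : Graph n → Fin n → Subset n
neighbours G i = tabulate (adj G i)

degree : Graph n → Fin n → ℕ
degree G i = ∣ neighbours G i ∣

IsMaxDegree : Graph n → ℕ → Set
IsMaxDegree G Δ = (∃[ i ] degree G i ≡ Δ) × (∀ i → degree G i ℕ.≤ Δ)

IsMinDegree : Graph n → ℕ → Set
IsMinDegree G δ = (∃[ i ] degree G i ≡ δ) × (∀ i → δ ℕ.≤ degree G i)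

------------------------------------------------------------------------
-- Ordered fields with a strict order and an apartness, without decidability
-- or trichotomy.

record OrderedField c ℓ₁ ℓ₂ : Set (lsuc (c ⊔ ℓ₁ ⊔ ℓ₂)) where
  infix 4 _<_ _≤_
  field
    heytingField : HeytingField c ℓ₁ ℓ₂

  open HeytingField heytingField public

  field
    _<_                  : Rel Carrier ℓ₂
    isStrictPartialOrder : IsStrictPartialOrder _≈_ _<_
    <⇒#                  : ∀ {x y} → x < y → x # y
    #⇒<⊎>                : ∀ {x y} → x # y → x < y ⊎ y < x
    +-monoˡ-<            : ∀ {x y} z → x < y → x + z < y + z
    *-pos                : ∀ {x y} → 0# < x → 0# < y → 0# < x * y

  _≤_ : Rel Carrier ℓ₂
  x ≤ y = ¬ (y < x)

  commutativeRing : CommutativeRing c ℓ₁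
  commutativeRing = record { isCommutativeRing = isCommutativeRing }

  open import Algebra.Definitions.RawSemiring
    (Semiring.rawSemiring (CommutativeRing.semiring commutativeRing)) public
    using (sum; product; _^_) renaming (_×_ to _×ℕ_)

  ⟦_⟧ : ℕ → Carrier
  ⟦ m ⟧ = m ×ℕ 1#

-- The real numbers, axiomatised as a Cauchy-complete Archimedean ordered
-- field. Classically these axioms determine ℝ up to isomorphism; the
-- constructive Cauchy reals are a model as well.

record RealNumbers c ℓ₁ ℓ₂ : Set (lsuc (c ⊔ ℓ₁ ⊔ ℓ₂)) where
  field
    orderedField : OrderedField c ℓ₁ ℓ₂

  open OrderedField orderedField public

  IsCauchy : (ℕ → Carrier) → Set (c ⊔ ℓ₂)
  IsCauchy s = ∀ ε → 0# < ε →
    ∃[ N ] (∀ p q → N ℕ.≤ p → N ℕ.≤ q → s p < s q + ε)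

  _ConvergesTo_ : (ℕ → Carrier) → Carrier → Set (c ⊔ ℓ₂)
  s ConvergesTo l = ∀ ε → 0# < ε →
    ∃[ N ] (∀ p → N ℕ.≤ p → (s p < l + ε) × (l < s p + ε))

  field
    archimedean : ∀ x → ∃[ m ] x < ⟦ m ⟧
    complete    : ∀ s → IsCauchy s → ∃[ l ] s ConvergesTo l

------------------------------------------------------------------------
-- Matrices and eigenvalues

module Spectral {c ℓ₁ ℓ₂} (ℝ : RealNumbers c ℓ₁ ℓ₂) where

  open RealNumbers ℝ hiding (zero)

  Matrix : ℕ → Set c
  Matrix n = Vector (Vector Carrier n) n

  -- Laplace expansion along the first row.
  det : Matrix n → Carrier
  det {zero}  M = 1#
  det {suc n} M = sum λ j →
    (- 1#) ^ toℕ j * (M zero j * det (λ p q → M (suc p) (punchIn j q)))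

  identity : Matrix n
  identity i j = if ⌊ i ≟ j ⌋ then 1# else 0#

  charPoly : Matrix n → Carrier → Carrier
  charPoly M x = det (λ i j → x * identity i j - M i j)

  -- ev lists the eigenvalues of M in non-increasing order, each repeated
  -- according to its multiplicity as a root of the characteristic
  -- polynomial. The field is infinite, so agreement at every point x is
  -- the same as equality of polynomials in x.
  record IsSpectrum (M : Matrix n) (ev : Vector Carrier n) : Set (c ⊔ ℓ₁ ⊔ ℓ₂) where
    field
      non-increasing : ∀ {i j} → i Fin.≤ j → ev j ≤ ev i
      roots          : ∀ x → charPoly M x ≈ product (λ i → x - ev i)

  S : ∀ {k} → k ℕ.≤ n → Vector Carrier n → Carrier
  S k≤n ev = sum λ i → ev (inject≤ i k≤n)

  A : Graph n → Matrix n
  A G i j = if adj G i j then 1# else 0#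

  D : Graph n → Matrix n
  D G i j = if ⌊ i ≟ j ⌋ then ⟦ degree G i ⟧ else 0#

  A[_] : Carrier → Graph n → Matrix n
  A[ α ] G i j = α * D G i j + (1# - α) * A G i j

{-# OPTIONS --safe #-}

-- No eigenvectors are used; everything is read off characteristic polynomials.
--
-- Upper bound. Let all degrees be at most b, and c = αb + (1-α)(n-1-j). Then cI - A_α(G) has nonpositive off-diagonal
-- entries, and its principal submatrices of size at most n-j have nonnegative row sums, hence nonnegative determinants.
-- So the coefficients of degree ≥ j of det (εI + cI - A_α(G)) are nonnegative, and by Descartes' rule of signs at most
-- j eigenvalues exceed c: with indices from 0, λ_j ≤ αb + (1-α)(n-1-j). Summing over j < k for G with b = Δ and for its
-- complement with b = n-1-δ gives exactly the bound.
--
-- Lower bound. Since λ is non-increasing, (n-1) S_k ≥ (n-k) λ_0 + (k-1) Σλ. The sum Σλ is the trace, and the two traces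
-- add up to αn(n-1). As λ_0 is at least the average of the row sums and the row sums are the degrees, the two largest
-- eigenvalues add up to at least n-1.
module Submission where

open import Algebra.Bundles using (CommutativeRing)
open import Data.Bool.Base using (Bool; true; false; if_then_else_; not; _∧_)
open import Data.Empty using (⊥)
open import Data.Fin.Base as Fin using (Fin; zero; suc; fromℕ; inject≤; punchIn; punchOut; toℕ)
open import Data.Fin.Properties
  using (_≟_; punchIn-injective; punchIn-punchOut; punchInᵢ≢i; suc-injective; toℕ-inject≤; toℕ<n; ≤fromℕ)
open import Data.Fin.Subset using (Subset; ∣_∣)
open import Data.List.Base using (List; []; _∷_; length; map)
open import Data.Nat.Base as ℕ using (ℕ; zero; suc; z≤n; s≤s)
import Data.Nat.Properties as ℕ
open import Data.Product.Base using (_×_; _,_; ∃-syntax; proj₁; proj₂)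
open import Data.Sum.Base using (_⊎_; inj₁; inj₂; [_,_]′)
open import Data.Unit.Base using (⊤)
open import Data.Vec.Base using ([]; _∷_; lookup; tabulate)
open import Data.Vec.Functional using (Vector; insertAt) renaming (_∷_ to _◂_)
open import Data.Vec.Functional.Properties using (insertAt-lookup; insertAt-punchIn)
open import Defs
open import Function.Base using (_∘_; id)
open import Level using (Lift; lift; _⊔_)
open import Relation.Binary.PropositionalEquality as ≡ using (_≡_; _≢_)
open import Relation.Binary.Structures using (IsStrictPartialOrder)
open import Relation.Nullary using (contradiction; yes; no)
open import Relation.Unary using (U)

-- The order is constructive: `<` is undecidable and `≤` is its negation. A spectrum supplies only a
-- factorisation of the characteristic polynomial, and eigenvectors do not depend continuously on
-- the matrix. What helps is that both eigenvalue bounds are `≤` statements: the opposite strict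
-- inequality may be assumed, and its gap can be exploited. The bound of λ_0 by the average row sum
-- r is therefore a power method. After a shift that makes all eigenvalues positive, Cauchy-Schwarz
-- carries the bound from M to its powers, and the trace of a power is at most n times that power of
-- λ_0; so r^(2^q) ≤ n λ_0^(2^q) for all q ≥ 1, and λ_0 < r would contradict the Archimedean
-- property. The exponents are powers of two because only squaring has to be understood: the
-- eigenvalues of M² come from det (x² - M²) = det (x - M) det (x + M). This needs a multiplicative
-- determinant, which is the reason for the theory of alternating functions; the same theory
-- supplies the row operations behind the nonnegative minors and the expansion of det (xI + T) in
-- powers of x.

-- A ring solver with integer coefficients

module IntegerSolver {a ℓ} (R : CommutativeRing a ℓ) where

  open import Algebra.Solver.Ring.AlmostCommutativeRing using (_-Raw-AlmostCommutative⟶_; fromCommutativeRing)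
  open import Data.Integer.Base as ℤ using (ℤ; +_; -[1+_]; _⊖_)
  import Data.Integer.Properties as ℤ
  open import Data.Maybe.Base as Maybe using (Maybe)
  import Data.Sign.Base as Sign
  open import Relation.Nullary.Decidable.Core using (dec⇒maybe)

  open CommutativeRing R hiding (zero)
  open import Algebra.Properties.Ring ring
  open import Algebra.Properties.AbelianGroup +-abelianGroup using (⁻¹-∙-comm)
  open import Algebra.Properties.Semiring.Mult.TCOptimised semiring renaming (_×_ to _⋆_)
  open import Relation.Binary.Reasoning.Setoid setoid

  private

    -- Equality of integers is decidable while equality in the ring is not, so normal forms have
    -- integer coefficients and cancellation is detected there. The optimised multiple makes 0 and 1
    -- reduce to the ring's own constants.
    embed : ℤ → Carrier
    embed (+ n)    = n ⋆ 1#
    embed -[1+ n ] = - (suc n ⋆ 1#)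

    embed-⊖ : ∀ m n → embed (m ⊖ n) ≈ m ⋆ 1# - n ⋆ 1#
    embed-⊖ m zero = sym (trans (+-congˡ -0#≈0#) (+-identityʳ _))
    embed-⊖ zero (suc n) = sym (+-identityˡ _)
    embed-⊖ (suc m) (suc n) = begin
      embed (suc m ⊖ suc n)                       ≡⟨ ≡.cong embed (ℤ.[1+m]⊖[1+n]≡m⊖n m n) ⟩
      embed (m ⊖ n)                               ≈⟨ embed-⊖ m n ⟩
      m ⋆ 1# - n ⋆ 1#                             ≈⟨ +-congʳ (+-identityʳ _) ⟨
      m ⋆ 1# + 0# - n ⋆ 1#                        ≈⟨ +-congʳ (+-congˡ (-‿inverseʳ 1#)) ⟨
      m ⋆ 1# + (1# - 1#) - n ⋆ 1#                 ≈⟨ +-congʳ (+-assoc _ _ _) ⟨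
      m ⋆ 1# + 1# - 1# - n ⋆ 1#                   ≈⟨ +-assoc _ _ _ ⟩
      m ⋆ 1# + 1# + (- 1# - n ⋆ 1#)               ≈⟨ +-cong (+-comm _ _) (⁻¹-∙-comm _ _) ⟩
      1# + m ⋆ 1# - (1# + n ⋆ 1#)                 ≈⟨ +-cong (1+× m 1#) (-‿cong (1+× n 1#)) ⟨
      suc m ⋆ 1# - suc n ⋆ 1#                     ∎

    embed-+ : ∀ i j → embed (i ℤ.+ j) ≈ embed i + embed j
    embed-+ (+ m) (+ n) = ×-homo-+ 1# m n
    embed-+ (+ m) -[1+ n ] = embed-⊖ m (suc n)
    embed-+ -[1+ m ] (+ n) = trans (embed-⊖ n (suc m)) (+-comm _ _)
    embed-+ -[1+ m ] -[1+ n ] = begin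
      - (suc (suc (m ℕ.+ n)) ⋆ 1#)     ≡⟨ ≡.cong (λ k → - (k ⋆ 1#)) (ℕ.+-suc (suc m) n) ⟨
      - ((suc m ℕ.+ suc n) ⋆ 1#)       ≈⟨ -‿cong (×-homo-+ 1# (suc m) (suc n)) ⟩
      - (suc m ⋆ 1# + suc n ⋆ 1#)      ≈⟨ ⁻¹-∙-comm _ _ ⟨
      - (suc m ⋆ 1#) - suc n ⋆ 1#      ∎

    embed-neg : ∀ i → embed (ℤ.- i) ≈ - embed i
    embed-neg (+ zero)  = sym -0#≈0#
    embed-neg (+ suc n) = refl
    embed-neg -[1+ n ]  = sym (-‿involutive _)

    embed-* : ∀ i j → embed (i ℤ.* j) ≈ embed i * embed j
    embed-* (+ m) (+ n) = trans (reflexive (≡.cong embed (ℤ.+◃n≡+n (m ℕ.* n)))) (×1-homo-* m n)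
    embed-* (+ m) -[1+ n ] = begin
      embed (Sign.- ℤ.◃ m ℕ.* suc n)   ≡⟨ ≡.cong embed (ℤ.-◃n≡-n (m ℕ.* suc n)) ⟩
      embed (ℤ.- (+ (m ℕ.* suc n)))    ≈⟨ embed-neg (+ (m ℕ.* suc n)) ⟩
      - ((m ℕ.* suc n) ⋆ 1#)           ≈⟨ -‿cong (×1-homo-* m (suc n)) ⟩
      - (m ⋆ 1# * suc n ⋆ 1#)          ≈⟨ -‿distribʳ-* _ _ ⟩
      m ⋆ 1# * - (suc n ⋆ 1#)          ∎
    embed-* -[1+ m ] (+ n) = begin
      embed (Sign.- ℤ.◃ suc m ℕ.* n)   ≡⟨ ≡.cong embed (ℤ.-◃n≡-n (suc m ℕ.* n)) ⟩
      embed (ℤ.- (+ (suc m ℕ.* n)))    ≈⟨ embed-neg (+ (suc m ℕ.* n)) ⟩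
      - ((suc m ℕ.* n) ⋆ 1#)           ≈⟨ -‿cong (×1-homo-* (suc m) n) ⟩
      - (suc m ⋆ 1# * n ⋆ 1#)          ≈⟨ -‿distribˡ-* _ _ ⟩
      - (suc m ⋆ 1#) * n ⋆ 1#          ∎
    embed-* -[1+ m ] -[1+ n ] = begin
      (suc m ℕ.* suc n) ⋆ 1#            ≈⟨ ×1-homo-* (suc m) (suc n) ⟩
      suc m ⋆ 1# * suc n ⋆ 1#           ≈⟨ -‿involutive _ ⟨
      - - (suc m ⋆ 1# * suc n ⋆ 1#)     ≈⟨ -‿cong (-‿distribˡ-* _ _) ⟩
      - (- (suc m ⋆ 1#) * suc n ⋆ 1#)   ≈⟨ -‿distribʳ-* _ _ ⟩
      - (suc m ⋆ 1#) * - (suc n ⋆ 1#)   ∎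

    morphism : ℤ.+-*-rawRing -Raw-AlmostCommutative⟶ fromCommutativeRing R
    morphism = record
      { ⟦_⟧    = embed
      ; +-homo = embed-+
      ; *-homo = embed-*
      ; -‿homo = embed-neg
      ; 0-homo = refl
      ; 1-homo = refl
      }

    embed-≟ : ∀ i j → Maybe (embed i ≈ embed j)
    embed-≟ i j = Maybe.map (λ i≡j → reflexive (≡.cong embed i≡j)) (dec⇒maybe (i ℤ.≟ j))

  open import Algebra.Solver.Ring ℤ.+-*-rawRing (fromCommutativeRing R) morphism embed-≟ public
    using (solve; _:=_; _:+_; _:*_; _:-_; :-_; con)
  open import Algebra.Solver.Ring ℤ.+-*-rawRing (fromCommutativeRing R) morphism embed-≟
    using (Polynomial)

  :0 :1 : ∀ {n} → Polynomial n
  :0 = con (+ 0)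
  :1 = con (+ 1)

-- Inequalities in an ordered field without trichotomy

module OrderedFieldProperties {c ℓ₁ ℓ₂} (𝔽 : OrderedField c ℓ₁ ℓ₂) where

  open OrderedField 𝔽 hiding (zero)
  open CommutativeRing commutativeRing using (semiring)
  open IntegerSolver commutativeRing
  open import Algebra.Properties.Semiring.Sum semiring using (sum-cong-≋; ∑-distrib-+; *-distribˡ-sum)
  open import Relation.Binary.Reasoning.Setoid setoid
  module < = IsStrictPartialOrder isStrictPartialOrder

  <-respˡ : ∀ {x y z} → x ≈ y → x < z → y < z
  <-respˡ = <.<-respˡ-≈
  <-respʳ : ∀ {x y z} → x ≈ y → z < x → z < y
  <-respʳ = <.<-respʳ-≈

  -- Comparison with a third point stands in for trichotomy: it makes the negative relation `≤`
  -- transitive and lets it be composed with `<`.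
  <-cotrans : ∀ {x y} → x < y → ∀ z → x < z ⊎ z < y
  <-cotrans x<y z with #-cotrans (<⇒# x<y) z
  ... | inj₁ x#z with #⇒<⊎> x#z
  ...   | inj₁ x<z = inj₁ x<z
  ...   | inj₂ z<x = inj₂ (<.trans z<x x<y)
  <-cotrans x<y z | inj₂ z#y with #⇒<⊎> z#y
  ...   | inj₁ z<y = inj₂ z<y
  ...   | inj₂ y<z = inj₁ (<.trans x<y y<z)

  <⇒≤ : ∀ {x y} → x < y → x ≤ y
  <⇒≤ x<y y<x = <.irrefl refl (<.trans x<y y<x)

  ≤-refl : ∀ {x} → x ≤ x
  ≤-refl = <.irrefl refl

  ≤-reflexive : ∀ {x y} → x ≈ y → x ≤ y
  ≤-reflexive x≈y y<x = <.irrefl (sym x≈y) y<x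

  ≤-respˡ : ∀ {x y z} → x ≈ y → x ≤ z → y ≤ z
  ≤-respˡ x≈y x≤z z<y = x≤z (<-respʳ (sym x≈y) z<y)
  ≤-respʳ : ∀ {x y z} → x ≈ y → z ≤ x → z ≤ y
  ≤-respʳ x≈y z≤x y<z = z≤x (<-respˡ (sym x≈y) y<z)

  ≤-trans : ∀ {x y z} → x ≤ y → y ≤ z → x ≤ z
  ≤-trans {y = y} x≤y y≤z z<x with <-cotrans z<x y
  ... | inj₁ z<y = y≤z z<y
  ... | inj₂ y<x = x≤y y<x

  <-≤-trans : ∀ {x y z} → x < y → y ≤ z → x < z
  <-≤-trans {z = z} x<y y≤z with <-cotrans x<y z
  ... | inj₁ x<z = x<z
  ... | inj₂ z<y = contradiction z<y y≤z

  ≤-<-trans : ∀ {x y z} → x ≤ y → y < z → x < z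
  ≤-<-trans {x} x≤y y<z with <-cotrans y<z x
  ... | inj₁ y<x = contradiction y<x x≤y
  ... | inj₂ x<z = x<z

  ≤-antisym : ∀ {x y} → x ≤ y → y ≤ x → x ≈ y
  ≤-antisym {x} {y} x≤y y≤x = proj₁ (tight x y) λ x#y → case (#⇒<⊎> x#y)
    where
    case : x < y ⊎ y < x → ⊥
    case (inj₁ x<y) = y≤x x<y
    case (inj₂ y<x) = x≤y y<x

  x<y⇒0<y-x : ∀ {x y} → x < y → 0# < y - x
  x<y⇒0<y-x {x} {y} x<y = <-respˡ (-‿inverseʳ x) (+-monoˡ-< (- x) x<y)

  0<y-x⇒x<y : ∀ {x y} → 0# < y - x → x < y
  0<y-x⇒x<y {x} {y} p =
    <-respˡ (+-identityˡ x) (<-respʳ (solve 2 (λ x y → y :- x :+ x := y) refl x y) (+-monoˡ-< x p))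

  -- The common shape of the inequality proofs, with `≤-by`: name a difference whose sign is evident
  -- and leave a ring identity to the solver.
  <-by : ∀ {x y d} → 0# < d → y - x ≈ d → x < y
  <-by 0<d e = 0<y-x⇒x<y (<-respʳ (sym e) 0<d)

  ≤-by : ∀ {x y d} → 0# ≤ d → y - x ≈ d → x ≤ y
  ≤-by {x} {y} {d} 0≤d e y<x = 0≤d (<-by (x<y⇒0<y-x y<x) lem)
    where
    lem : 0# - d ≈ x - y
    lem = trans (+-congˡ (-‿cong (sym e))) (solve 2 (λ x y → :0 :- (y :- x) := x :- y) refl x y)

  x≤y⇒0≤y-x : ∀ {x y} → x ≤ y → 0# ≤ y - x
  x≤y⇒0≤y-x {x} {y} x≤y p = x≤y (<-by (x<y⇒0<y-x p) (solve 2 (λ x y → x :- y := :0 :- (y :- x)) refl x y))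

  0<x+y : ∀ {x y} → 0# < x → 0# ≤ y → 0# < x + y
  0<x+y {x} {y} 0<x 0≤y = <-≤-trans 0<x (≤-by 0≤y (solve 2 (λ x y → x :+ y :- x := y) refl x y))

  0≤x+y : ∀ {x y} → 0# ≤ x → 0# ≤ y → 0# ≤ x + y
  0≤x+y {x} {y} 0≤x 0≤y = ≤-trans 0≤x (≤-by 0≤y (solve 2 (λ x y → x :+ y :- x := y) refl x y))

  +-mono-≤ : ∀ {x y u v} → x ≤ y → u ≤ v → x + u ≤ y + v
  +-mono-≤ {x} {y} {u} {v} x≤y u≤v = ≤-by (0≤x+y (x≤y⇒0≤y-x x≤y) (x≤y⇒0≤y-x u≤v))
    (solve 4 (λ x y u v → y :+ v :- (x :+ u) := (y :- x) :+ (v :- u)) refl x y u v)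

  x≤0⇒0≤-x : ∀ {x} → x ≤ 0# → 0# ≤ - x
  x≤0⇒0≤-x {x} x≤0 = ≤-respʳ (+-identityˡ (- x)) (x≤y⇒0≤y-x x≤0)

  xy#0⇒x#0 : ∀ {x y} → x * y # 0# → x # 0#
  xy#0⇒x#0 {x} {y} xy#0 with #⇒invertible xy#0
  ... | z , zxy≈1 , _ = invertible⇒# (y * z , lem₁ , trans (*-comm _ _) lem₁)
    where
    lem₁ : y * z * (x - 0#) ≈ 1#
    lem₁ = trans (solve 3 (λ x y z → y :* z :* (x :- :0) := z :* (x :* y :- :0)) refl x y z) zxy≈1

  positive : ∀ {x} → 0# ≤ x → x # 0# → 0# < x
  positive 0≤x x#0 = [ (λ x<0 → contradiction x<0 0≤x) , id ]′ (#⇒<⊎> x#0)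

  -- No case distinction on signs is possible, but the claim is a negation: assuming a negative
  -- product makes both factors invertible, hence apart from 0, hence strictly positive.
  0≤x*y : ∀ {x y} → 0# ≤ x → 0# ≤ y → 0# ≤ x * y
  0≤x*y {x} {y} 0≤x 0≤y xy<0 = <⇒≤ (*-pos 0<x 0<y) xy<0
    where
    0<x : 0# < x
    0<x = positive 0≤x (xy#0⇒x#0 {x} {y} (<⇒# xy<0))
    0<y : 0# < y
    0<y = positive 0≤y (xy#0⇒x#0 {y} {x} (<⇒# (<-respˡ (*-comm x y) xy<0)))

  0≤x² : ∀ x → 0# ≤ x * x
  0≤x² x xx<0 = [ neg , (λ 0<x → <⇒≤ (*-pos 0<x 0<x) xx<0) ]′ (#⇒<⊎> (xy#0⇒x#0 {x} {x} (<⇒# xx<0)))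
    where
    neg : x < 0# → ⊥
    neg x<0 = <⇒≤ (<-respʳ (solve 1 (λ x → (:0 :- x) :* (:0 :- x) := x :* x) refl x)
                    (*-pos (x<y⇒0<y-x x<0) (x<y⇒0<y-x x<0))) xx<0

  0<1 : 0# < 1#
  0<1 = [ (λ 1<0 → contradiction (<-respˡ (sym (*-identityˡ 1#)) 1<0) (0≤x² 1#)) , id ]′
          (#⇒<⊎> (invertible⇒# {1#} {0#} (1# , lem , trans (*-comm _ _) lem)))
    where
    lem : 1# * (1# - 0#) ≈ 1#
    lem = solve 0 (:1 :* (:1 :- :0) := :1) refl

  0≤1 : 0# ≤ 1#
  0≤1 = <⇒≤ 0<1

  x<x+1 : ∀ x → x < x + 1#
  x<x+1 x = <-by 0<1 (solve 1 (λ x → x :+ :1 :- x := :1) refl x)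

  *-monoˡ-≤ : ∀ {x y z} → 0# ≤ z → x ≤ y → z * x ≤ z * y
  *-monoˡ-≤ {x} {y} {z} 0≤z x≤y = ≤-by (0≤x*y 0≤z (x≤y⇒0≤y-x x≤y))
    (solve 3 (λ x y z → z :* y :- z :* x := z :* (y :- x)) refl x y z)

  *-cancelˡ-≤ : ∀ {x y z} → 0# < z → z * x ≤ z * y → x ≤ y
  *-cancelˡ-≤ {x} {y} {z} 0<z zx≤zy y<x = zx≤zy (<-by (*-pos 0<z (x<y⇒0<y-x y<x))
    (solve 3 (λ x y z → z :* x :- z :* y := z :* (x :- y)) refl x y z))

  x²≤y² : ∀ {x y} → 0# ≤ x → x ≤ y → x * x ≤ y * y
  x²≤y² {x} {y} 0≤x x≤y = ≤-by (0≤x*y (x≤y⇒0≤y-x x≤y) (0≤x+y 0≤x (≤-trans 0≤x x≤y)))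
    (solve 2 (λ x y → y :* y :- x :* x := (y :- x) :* (x :+ y)) refl x y)

  *-cancelˡ : ∀ {x y z} → 0# < z → z * x ≈ z * y → x ≈ y
  *-cancelˡ 0<z zx≈zy = ≤-antisym (*-cancelˡ-≤ 0<z (≤-reflexive zx≈zy)) (*-cancelˡ-≤ 0<z (≤-reflexive (sym zx≈zy)))

  xy≈0∧0<x⇒y≈0 : ∀ {x y} → 0# < x → x * y ≈ 0# → y ≈ 0#
  xy≈0∧0<x⇒y≈0 {x} 0<x xy≈0 = *-cancelˡ 0<x (trans xy≈0 (sym (zeroʳ x)))

  0<x⇒inverse : ∀ {x} → 0# < x → ∃[ y ] 0# < y × x * y ≈ 1#
  0<x⇒inverse {x} 0<x with #⇒invertible (#-sym (<⇒# 0<x))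
  ... | y , _ , e = y , 0<y , xy≈1
    where
    xy≈1 : x * y ≈ 1#
    xy≈1 = trans (solve 2 (λ x y → x :* y := (x :- :0) :* y) refl x y) e
    0<y : 0# < y
    0<y = [ (λ y<0 → contradiction (neg y<0) 0≤1) , id ]′
            (#⇒<⊎> (xy#0⇒x#0 {y} {x} (#-sym (<⇒# (<-respʳ (trans (sym xy≈1) (*-comm x y)) 0<1)))))
      where
      neg : y < 0# → 1# < 0#
      neg y<0 = <-by (*-pos 0<x (x<y⇒0<y-x y<0)) (trans (+-congˡ (-‿cong (sym xy≈1)))
             (solve 2 (λ x y → :0 :- x :* y := x :* (:0 :- y)) refl x y))

  0≤⟦n⟧ : ∀ n → 0# ≤ ⟦ n ⟧
  0≤⟦n⟧ zero    = ≤-refl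
  0≤⟦n⟧ (suc n) = 0≤x+y 0≤1 (0≤⟦n⟧ n)

  0<⟦1+n⟧ : ∀ n → 0# < ⟦ suc n ⟧
  0<⟦1+n⟧ n = 0<x+y 0<1 (0≤⟦n⟧ n)

  ⟦⟧-mono : ∀ {m n} → m ℕ.≤ n → ⟦ m ⟧ ≤ ⟦ n ⟧
  ⟦⟧-mono {n = n} ℕ.z≤n = 0≤⟦n⟧ n
  ⟦⟧-mono (ℕ.s≤s m≤n) = +-mono-≤ ≤-refl (⟦⟧-mono m≤n)

  ⟦⟧-+ : ∀ m n → ⟦ m ℕ.+ n ⟧ ≈ ⟦ m ⟧ + ⟦ n ⟧
  ⟦⟧-+ zero    n = sym (+-identityˡ _)
  ⟦⟧-+ (suc m) n = trans (+-congˡ (⟦⟧-+ m n)) (sym (+-assoc _ _ _))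

  sum-mono : ∀ {n} {f g : Fin n → Carrier} → (∀ i → f i ≤ g i) → sum f ≤ sum g
  sum-mono {zero}  f≤g = ≤-refl
  sum-mono {suc n} f≤g = +-mono-≤ (f≤g zero) (sum-mono (f≤g ∘ suc))

  sum-cong : ∀ {n} {f g : Fin n → Carrier} → (∀ i → f i ≈ g i) → sum f ≈ sum g
  sum-cong = sum-cong-≋

  sum-const : ∀ n x → sum {n} (λ _ → x) ≈ ⟦ n ⟧ * x
  sum-const zero    x = sym (zeroˡ x)
  sum-const (suc n) x = trans (+-congˡ (sum-const n x)) (solve 2 (λ x m → x :+ m :* x := (:1 :+ m) :* x) refl x ⟦ n ⟧)

  sum-0 : ∀ {n} {f : Fin n → Carrier} → (∀ i → f i ≈ 0#) → sum f ≈ 0#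
  sum-0 {n} f≈0 = trans (sum-cong f≈0) (trans (sum-const n 0#) (zeroʳ _))

  sum-nonneg : ∀ {n} {f : Fin n → Carrier} → (∀ i → 0# ≤ f i) → 0# ≤ sum f
  sum-nonneg {n} 0≤f = ≤-respˡ (sum-0 {n} λ _ → refl) (sum-mono 0≤f)

  -- Cauchy-Schwarz against the all-ones vector. Prepending x to `f` raises n Σf² - (Σf)² by the sum
  -- of the squares (x - f i)².
  square-sum : ∀ {n} (f : Fin n → Carrier) → sum f * sum f ≤ ⟦ n ⟧ * sum (λ i → f i * f i)
  square-sum {zero}  f = ≤-reflexive (trans (zeroˡ _) (sym (zeroˡ _)))
  square-sum {suc n} f = ≤-by
    (0≤x+y (x≤y⇒0≤y-x (square-sum (f ∘ suc))) (sum-nonneg λ i → 0≤x² (f zero - f (suc i))))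
    (begin
      (1# + N) * (x * x + Q) - (x + s) * (x + s)
        ≈⟨ solve 4 (λ N x Q s → (:1 :+ N) :* (x :* x :+ Q) :- (x :+ s) :* (x :+ s)
                      := (N :* Q :- s :* s) :+ (N :* (x :* x) :+ ((:- (x :+ x)) :* s :+ Q))) refl N x Q s ⟩
      (N * Q - s * s) + (N * (x * x) + (- (x + x) * s + Q))
        ≈⟨ +-congˡ (+-cong (sym (sum-const n _)) (+-congʳ (*-distribˡ-sum _ (f ∘ suc)))) ⟩
      (N * Q - s * s) + (sum {n} (λ _ → x * x) + (sum (λ i → - (x + x) * f (suc i)) + Q))
        ≈⟨ +-congˡ (+-congˡ (∑-distrib-+ (λ i → - (x + x) * f (suc i)) _)) ⟨
      (N * Q - s * s) + (sum {n} (λ _ → x * x) + sum (λ i → - (x + x) * f (suc i) + f (suc i) * f (suc i)))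
        ≈⟨ +-congˡ (∑-distrib-+ {n} (λ _ → x * x) _) ⟨
      (N * Q - s * s) + sum (λ i → x * x + (- (x + x) * f (suc i) + f (suc i) * f (suc i)))
        ≈⟨ +-congˡ (sum-cong λ i → solve 2 (λ x y → x :* x :+ ((:- (x :+ x)) :* y :+ y :* y) := (x :- y) :* (x :- y))
            refl x (f (suc i))) ⟩
      (N * Q - s * s) + sum (λ i → (x - f (suc i)) * (x - f (suc i))) ∎)
    where
    N = ⟦ n ⟧
    x = f zero
    s = sum (f ∘ suc)
    Q = sum (λ i → f (suc i) * f (suc i))

-- Polynomials, their coefficients and Descartes' rule of signs

module Polynomials {c ℓ₁ ℓ₂} (𝔽 : OrderedField c ℓ₁ ℓ₂) where

  open OrderedField 𝔽 hiding (zero)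
  open OrderedFieldProperties 𝔽
  open IntegerSolver commutativeRing
  open import Relation.Binary.Reasoning.Setoid setoid

  -- Coefficients from the constant term upwards. Trailing zeros must be allowed, as a coefficient
  -- cannot be tested for zero; polynomials are therefore compared through `coeff` and not as lists.
  Polynomial : Set c
  Polynomial = List Carrier

  eval : Polynomial → Carrier → Carrier
  eval []      x = 0#
  eval (a ∷ p) x = a + x * eval p x

  coeff : ℕ → Polynomial → Carrier
  coeff _       []      = 0#
  coeff zero    (a ∷ p) = a
  coeff (suc m) (a ∷ p) = coeff m p

  infixl 6 _⊕_
  _⊕_ : Polynomial → Polynomial → Polynomial
  []      ⊕ q       = q
  (a ∷ p) ⊕ []      = a ∷ p
  (a ∷ p) ⊕ (b ∷ q) = a + b ∷ p ⊕ q

  infixl 7 _⊙_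
  _⊙_ : Carrier → Polynomial → Polynomial
  a ⊙ p = map (a *_) p

  eval-⊕ : ∀ p q x → eval (p ⊕ q) x ≈ eval p x + eval q x
  eval-⊕ []      q       x = sym (+-identityˡ _)
  eval-⊕ (a ∷ p) []      x = sym (+-identityʳ _)
  eval-⊕ (a ∷ p) (b ∷ q) x = trans (+-congˡ (*-congˡ (eval-⊕ p q x)))
    (solve 5 (λ a b x p q → a :+ b :+ x :* (p :+ q) := a :+ x :* p :+ (b :+ x :* q)) refl a b x (eval p x) (eval q x))

  coeff-⊕ : ∀ m p q → coeff m (p ⊕ q) ≈ coeff m p + coeff m q
  coeff-⊕ m       []      q       = sym (+-identityˡ _)
  coeff-⊕ m       (a ∷ p) []      = sym (+-identityʳ _)
  coeff-⊕ zero    (a ∷ p) (b ∷ q) = refl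
  coeff-⊕ (suc m) (a ∷ p) (b ∷ q) = coeff-⊕ m p q

  eval-⊙ : ∀ a p x → eval (a ⊙ p) x ≈ a * eval p x
  eval-⊙ a []      x = sym (zeroʳ a)
  eval-⊙ a (b ∷ p) x = trans (+-congˡ (*-congˡ (eval-⊙ a p x)))
    (solve 4 (λ a b x p → a :* b :+ x :* (a :* p) := a :* (b :+ x :* p)) refl a b x (eval p x))

  coeff-⊙ : ∀ m a p → coeff m (a ⊙ p) ≈ a * coeff m p
  coeff-⊙ m       a []      = sym (zeroʳ a)
  coeff-⊙ zero    a (b ∷ p) = refl
  coeff-⊙ (suc m) a (b ∷ p) = coeff-⊙ m a p

  -- Synthetic division: quotient r p is the quotient of a ∷ p by x - r, for every constant term a.
  quotient : Carrier → Polynomial → Polynomial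
  quotient r []      = []
  quotient r (b ∷ p) = eval (b ∷ p) r ∷ quotient r p

  length-quotient : ∀ r p → length (quotient r p) ≡ length p
  length-quotient r []      = ≡.refl
  length-quotient r (b ∷ p) = ≡.cong suc (length-quotient r p)

  eval-quotient : ∀ a p r x → eval (a ∷ p) x ≈ eval (a ∷ p) r + (x - r) * eval (quotient r p) x
  eval-quotient a [] r x = solve 3 (λ a r x → a :+ x :* :0 := a :+ r :* :0 :+ (x :- r) :* :0) refl a r x
  eval-quotient a (b ∷ p) r x = trans (+-congˡ (*-congˡ (eval-quotient b p r x)))
    (solve 5 (λ a x r E q → a :+ x :* (E :+ (x :- r) :* q) := a :+ r :* E :+ (x :- r) :* (E :+ x :* q)) refl
       a x r (eval (b ∷ p) r) (eval (quotient r p) x))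

  eval-zero : ∀ p → (∀ m → coeff m p ≈ 0#) → ∀ x → eval p x ≈ 0#
  eval-zero []      p≈0 x = refl
  eval-zero (a ∷ p) p≈0 x = trans (+-cong (p≈0 0) (trans (*-congˡ (eval-zero p (p≈0 ∘ suc) x)) (zeroʳ x))) (+-identityʳ 0#)

  quotient-zero : ∀ r p → (∀ m → coeff m (quotient r p) ≈ 0#) → ∀ m → coeff m p ≈ 0#
  quotient-zero r []      q≈0 m       = refl
  quotient-zero r (b ∷ p) q≈0 (suc m) = quotient-zero r p (q≈0 ∘ suc) m
  quotient-zero r (b ∷ p) q≈0 zero    = begin
    b
      ≈⟨ trans (+-congˡ (trans (*-congˡ (eval-zero p (quotient-zero r p (q≈0 ∘ suc)) r)) (zeroʳ r))) (+-identityʳ b) ⟨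
    b + r * eval p r ≈⟨ q≈0 0 ⟩
    0#               ∎

  -- The sample set is a parameter because the characteristic polynomial of M² is at first known
  -- only at squares.
  module _ {ℓ} (X : Carrier → Set ℓ) (unbounded : ∀ y → ∃[ x ] y < x × X x) where

    -- Take a root r in `X` above y and divide by x - r. The quotient vanishes at the points of `X`
    -- above r, where x - r is positive and can be cancelled; this is why the threshold moves. The
    -- recursion is on the length, since the quotient is not a sublist.
    vanishing : ∀ n p → length p ≡ n → ∀ y → (∀ x → y < x → X x → eval p x ≈ 0#) → ∀ m → coeff m p ≈ 0#
    vanishing zero    []      e y p≈0 m = refl
    vanishing (suc n) (a ∷ p) e y p≈0 = coefficients
      where
      r = proj₁ (unbounded y)
      y<r = proj₁ (proj₂ (unbounded y))
      r∈X = proj₂ (proj₂ (unbounded y))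

      tail≈0 : ∀ m → coeff m p ≈ 0#
      tail≈0 = quotient-zero r p (vanishing n (quotient r p) (≡.trans (length-quotient r p) (ℕ.suc-injective e)) r λ x r<x x∈X →
        xy≈0∧0<x⇒y≈0 (x<y⇒0<y-x r<x) (begin
          (x - r) * eval (quotient r p) x                    ≈⟨ +-identityˡ _ ⟨
          0# + (x - r) * eval (quotient r p) x               ≈⟨ +-congʳ (p≈0 r y<r r∈X) ⟨
          eval (a ∷ p) r + (x - r) * eval (quotient r p) x   ≈⟨ eval-quotient a p r x ⟨
          eval (a ∷ p) x                                     ≈⟨ p≈0 x (<.trans y<r r<x) x∈X ⟩
          0#                                                 ∎))

      coefficients : ∀ m → coeff m (a ∷ p) ≈ 0#
      coefficients (suc m) = tail≈0 m
      coefficients zero    = begin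
        a                ≈⟨ trans (+-congˡ (trans (*-congˡ (eval-zero p tail≈0 r)) (zeroʳ r))) (+-identityʳ a) ⟨
        eval (a ∷ p) r   ≈⟨ p≈0 r y<r r∈X ⟩
        0#               ∎

    coeff-unique : ∀ p q y → (∀ x → y < x → X x → eval p x ≈ eval q x) → ∀ m → coeff m p ≈ coeff m q
    coeff-unique p q y p≈q m = begin
      coeff m p
        ≈⟨ solve 2 (λ a b → a := a :+ (:- :1) :* b :+ b) refl (coeff m p) (coeff m q) ⟩
      coeff m p + - 1# * coeff m q + coeff m q     ≈⟨ +-congʳ (trans (coeff-⊕ m p _) (+-congˡ (coeff-⊙ m (- 1#) q))) ⟨
      coeff m (p ⊕ - 1# ⊙ q) + coeff m q
        ≈⟨ +-congʳ (vanishing _ (p ⊕ - 1# ⊙ q) ≡.refl y (λ x y<x x∈X →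
             trans (eval-⊕ p _ x) (trans (+-cong (p≈q x y<x x∈X) (eval-⊙ (- 1#) q x))
               (solve 1 (λ a → a :+ (:- :1) :* a := :0) refl (eval q x)))) m) ⟩
      0# + coeff m q                               ≈⟨ +-identityˡ _ ⟩
      coeff m q                                    ∎

  eval-cong : ∀ p q → (∀ m → coeff m p ≈ coeff m q) → ∀ x → eval p x ≈ eval q x
  eval-cong []      q       p≈q x = sym (eval-zero q (λ m → sym (p≈q m)) x)
  eval-cong (a ∷ p) []      p≈q x = eval-zero (a ∷ p) p≈q x
  eval-cong (a ∷ p) (b ∷ q) p≈q x = +-cong (p≈q 0) (*-congˡ (eval-cong p q (p≈q ∘ suc) x))

  U-unbounded : ∀ y → ∃[ x ] y < x × U x
  U-unbounded y = y + 1# , x<x+1 y , _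

  fromRoots : ∀ {n} → Vector Carrier n → Polynomial
  fromRoots {zero}  r = 1# ∷ []
  fromRoots {suc n} r = (0# ∷ fromRoots (r ∘ suc)) ⊕ - r zero ⊙ fromRoots (r ∘ suc)

  eval-fromRoots : ∀ {n} (r : Vector Carrier n) x → eval (fromRoots r) x ≈ product (λ i → x - r i)
  eval-fromRoots {zero}  r x = trans (+-congˡ (zeroʳ x)) (+-identityʳ 1#)
  eval-fromRoots {suc n} r x = begin
    eval ((0# ∷ p) ⊕ - r zero ⊙ p) x            ≈⟨ eval-⊕ (0# ∷ p) (- r zero ⊙ p) x ⟩
    0# + x * eval p x + eval (- r zero ⊙ p) x   ≈⟨ +-congˡ (eval-⊙ (- r zero) p x) ⟩
    0# + x * eval p x + - r zero * eval p x
      ≈⟨ solve 3 (λ x r e → :0 :+ x :* e :+ (:- r) :* e := (x :- r) :* e) refl x (r zero) (eval p x) ⟩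
    (x - r zero) * eval p x                     ≈⟨ *-congˡ (eval-fromRoots (r ∘ suc) x) ⟩
    (x - r zero) * product (λ i → x - r (suc i)) ∎
    where p = fromRoots (r ∘ suc)

  fromRoots-degree : ∀ {n} (r : Vector Carrier n) m → n ℕ.< m → coeff m (fromRoots r) ≈ 0#
  fromRoots-degree {zero}  r (suc m) n<m       = refl
  fromRoots-degree {suc n} r (suc m) (s≤s n<m) = begin
    coeff (suc m) ((0# ∷ p) ⊕ - r zero ⊙ p)        ≈⟨ coeff-⊕ (suc m) (0# ∷ p) (- r zero ⊙ p) ⟩
    coeff m p + coeff (suc m) (- r zero ⊙ p)       ≈⟨ +-congˡ (coeff-⊙ (suc m) (- r zero) p) ⟩
    coeff m p + - r zero * coeff (suc m) p
      ≈⟨ +-cong (fromRoots-degree (r ∘ suc) m n<m) (*-congˡ (fromRoots-degree (r ∘ suc) (suc m) (ℕ.m<n⇒m<1+n n<m))) ⟩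
    0# + - r zero * 0#                             ≈⟨ solve 1 (λ r → :0 :+ r :* :0 := :0) refl (- r zero) ⟩
    0#                                             ∎
    where p = fromRoots (r ∘ suc)

  fromRoots-monic : ∀ {n} (r : Vector Carrier n) → coeff n (fromRoots r) ≈ 1#
  fromRoots-monic {zero}  r = refl
  fromRoots-monic {suc n} r = begin
    coeff (suc n) ((0# ∷ p) ⊕ - r zero ⊙ p)        ≈⟨ coeff-⊕ (suc n) (0# ∷ p) (- r zero ⊙ p) ⟩
    coeff n p + coeff (suc n) (- r zero ⊙ p)       ≈⟨ +-congˡ (coeff-⊙ (suc n) (- r zero) p) ⟩
    coeff n p + - r zero * coeff (suc n) p
      ≈⟨ +-cong (fromRoots-monic (r ∘ suc)) (*-congˡ (fromRoots-degree (r ∘ suc) (suc n) (ℕ.n<1+n n))) ⟩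
    1# + - r zero * 0#                             ≈⟨ solve 1 (λ r → :1 :+ r :* :0 := :1) refl (- r zero) ⟩
    1#                                             ∎
    where p = fromRoots (r ∘ suc)

  -- Multiplying by x makes the index uniform: the coefficient n of x p is the subleading coefficient of p,
  -- and 0 for n = 0.
  fromRoots-subleading : ∀ {n} (r : Vector Carrier n) → coeff n (0# ∷ fromRoots r) ≈ - sum r
  fromRoots-subleading {zero}  r = solve 0 (:0 := :- :0) refl
  fromRoots-subleading {suc n} r = begin
    coeff n ((0# ∷ p) ⊕ - r zero ⊙ p)              ≈⟨ coeff-⊕ n (0# ∷ p) (- r zero ⊙ p) ⟩
    coeff n (0# ∷ p) + coeff n (- r zero ⊙ p)      ≈⟨ +-cong (fromRoots-subleading (r ∘ suc)) (coeff-⊙ n (- r zero) p) ⟩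
    - sum (r ∘ suc) + - r zero * coeff n p         ≈⟨ +-congˡ (*-congˡ (fromRoots-monic (r ∘ suc))) ⟩
    - sum (r ∘ suc) + - r zero * 1#
      ≈⟨ solve 2 (λ s r → (:- s) :+ (:- r) :* :1 := :- (r :+ s)) refl (sum (r ∘ suc)) (r zero) ⟩
    - (r zero + sum (r ∘ suc))                     ∎
    where p = fromRoots (r ∘ suc)

  eval-nonneg : ∀ p {x} → 0# ≤ x → (∀ m → 0# ≤ coeff m p) → 0# ≤ eval p x
  eval-nonneg []      0≤x 0≤p = ≤-refl
  eval-nonneg (a ∷ p) 0≤x 0≤p = 0≤x+y (0≤p 0) (0≤x*y 0≤x (eval-nonneg p 0≤x (0≤p ∘ suc)))

  -- By Horner's scheme, coefficient m of the quotient is the value at r of `p` with its first m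
  -- coefficients dropped.
  quotient-nonneg : ∀ r p m → 0# ≤ r → (∀ l → m ℕ.≤ l → 0# ≤ coeff l p) → 0# ≤ coeff m (quotient r p)
  quotient-nonneg r []      m       0≤r 0≤p = ≤-refl
  quotient-nonneg r (b ∷ p) zero    0≤r 0≤p = eval-nonneg (b ∷ p) 0≤r λ m → 0≤p m z≤n
  quotient-nonneg r (b ∷ p) (suc m) 0≤r 0≤p = quotient-nonneg r p m 0≤r λ l m≤l → 0≤p (suc l) (s≤s m≤l)

  -- A vanishing sum of nonnegative terms has only zero terms, and powers of a positive root can be
  -- cancelled from them.
  nonneg-root⇒zero : ∀ p {r} → 0# < r → (∀ m → 0# ≤ coeff m p) → eval p r ≈ 0# → ∀ m → coeff m p ≈ 0#
  nonneg-root⇒zero []      0<r 0≤p e m = refl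
  nonneg-root⇒zero (a ∷ p) {r} 0<r 0≤p e = coefficients
    where
    0≤rE : 0# ≤ r * eval p r
    0≤rE = 0≤x*y (<⇒≤ 0<r) (eval-nonneg p (<⇒≤ 0<r) (0≤p ∘ suc))
    coefficients : ∀ m → coeff m (a ∷ p) ≈ 0#
    coefficients zero    = ≤-antisym (≤-respʳ e (≤-by 0≤rE (solve 2 (λ a b → a :+ b :- a := b) refl a _))) (0≤p 0)
    coefficients (suc m) = nonneg-root⇒zero p 0<r (0≤p ∘ suc) (xy≈0∧0<x⇒y≈0 0<r
      (≤-antisym (≤-respʳ e (≤-by (0≤p 0) (solve 2 (λ a b → a :+ b :- b := a) refl a _))) 0≤rE)) m

  product-pos : ∀ {n} {f : Fin n → Carrier} → (∀ i → 0# < f i) → 0# < product f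
  product-pos {zero}  0<f = 0<1
  product-pos {suc n} 0<f = *-pos (0<f zero) (product-pos (0<f ∘ suc))

  -- If the coefficients of degree ≥ j are nonnegative there are at most j sign changes, hence at most j positive roots;
  -- dividing by x - r with r > 0 lowers j by one.
  descartes : ∀ j {n} p (r : Vector Carrier n) → (∀ x → eval p x ≈ product (λ i → x - r i)) →
    (∀ m → j ℕ.≤ m → 0# ≤ coeff m p) → ∀ b → (∀ i → r i < b) →
    j ℕ.< n → (∀ i → toℕ i ℕ.≤ j → 0# < r i) → ⊥
  -- The zero polynomial is no product of linear factors: at b, above all roots, the product is
  -- positive.
  descartes j {suc n} [] r roots 0≤p b r<b _ 0<r =
    <.irrefl (roots b) (product-pos λ i → x<y⇒0<y-x (r<b i))
  descartes zero {suc n} p@(_ ∷ _) r roots 0≤p b r<b _ 0<r =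
    <.irrefl (trans (sym (eval-zero p p≈0 b)) (roots b)) (product-pos λ i → x<y⇒0<y-x (r<b i))
    where
    p≈0 : ∀ m → coeff m p ≈ 0#
    p≈0 = nonneg-root⇒zero p (0<r zero z≤n) (λ m → 0≤p m z≤n)
      (trans (roots (r zero)) (trans (*-congʳ (-‿inverseʳ _)) (zeroˡ _)))
  descartes (suc j) {suc n} (a ∷ p) r roots 0≤p b r<b (s≤s j<n) 0<r =
    descartes j q (r ∘ suc) (λ x → trans (eval-cong q (fromRoots (r ∘ suc)) q≈ x) (eval-fromRoots (r ∘ suc) x))
      (λ m j≤m → quotient-nonneg r₀ p m (<⇒≤ (0<r zero z≤n)) λ l m≤l → 0≤p (suc l) (s≤s (ℕ.≤-trans j≤m m≤l)))
      b (r<b ∘ suc) j<n (λ i i≤j → 0<r (suc i) (s≤s i≤j))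
    where
    r₀ = r zero
    q = quotient r₀ p

    -- Only for x > r₀ can the factor x - r₀ be cancelled. Comparing coefficients extends the
    -- factorisation of the quotient to all x.
    q≈ : ∀ m → coeff m q ≈ coeff m (fromRoots (r ∘ suc))
    q≈ = coeff-unique U U-unbounded q (fromRoots (r ∘ suc)) r₀ λ x r₀<x _ → *-cancelˡ (x<y⇒0<y-x r₀<x) (begin
      (x - r₀) * eval q x                           ≈⟨ +-identityˡ _ ⟨
      0# + (x - r₀) * eval q x
        ≈⟨ +-congʳ (trans (roots r₀) (trans (*-congʳ (-‿inverseʳ _)) (zeroˡ _))) ⟨
      eval (a ∷ p) r₀ + (x - r₀) * eval q x         ≈⟨ eval-quotient a p r₀ x ⟨
      eval (a ∷ p) x                                ≈⟨ roots x ⟩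
      (x - r₀) * product (λ i → x - r (suc i))      ≈⟨ *-congˡ (eval-fromRoots (r ∘ suc) x) ⟨
      (x - r₀) * eval (fromRoots (r ∘ suc)) x       ∎)

module SpectralProperties {c ℓ₁ ℓ₂} (ℝ : RealNumbers c ℓ₁ ℓ₂) where

  open RealNumbers ℝ hiding (zero)
  open Spectral ℝ
  open CommutativeRing commutativeRing using (semiring)
  open OrderedFieldProperties orderedField
  open Polynomials orderedField
  open IntegerSolver commutativeRing
  open import Algebra.Properties.Semiring.Sum semiring using (∑-distrib-+; *-distribˡ-sum; *-distribʳ-sum; ∑-comm)
  open import Relation.Binary.Reasoning.Setoid setoid

  private
    variable
      k l m n : ℕ

  -- Determinants

  sgn : ℕ → Carrier
  sgn k = (- 1#) ^ k

  det-cong : {M N : Matrix n} → (∀ i j → M i j ≈ N i j) → det M ≈ det N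
  det-cong {zero}  M≈N = refl
  det-cong {suc n} M≈N = sum-cong λ j →
    *-congˡ {sgn (toℕ j)} (*-cong (M≈N zero j) (det-cong λ p q → M≈N (suc p) (punchIn j q)))

  -- The corner terms agree. Each other minor of the row expansion contains the first column and
  -- each other minor of the column expansion the first row; expanding once more, both sides are the
  -- same double sum over minors with two rows and two columns removed.
  det-first-column : (M : Matrix (suc n)) →
    det M ≈ sum λ i → sgn (toℕ i) * (M i zero * det (λ p q → M (punchIn i p) (suc q)))
  det-first-column {zero}  M = refl
  det-first-column {suc n} M = +-congˡ (begin
    sum (λ j → sgn (suc (toℕ j)) * (a j * det (λ p q → M (suc p) (punchIn (suc j) q))))
      ≈⟨ sum-cong (λ j → *-congˡ {sgn (suc (toℕ j))} (*-congˡ {a j} (det-first-column (λ p q → M (suc p) (punchIn (suc j) q))))) ⟩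
    sum (λ j → sgn (suc (toℕ j)) * (a j * sum λ i → sgn (toℕ i) * (b i * d i j)))
      ≈⟨ sum-cong (λ j → pull (sgn (suc (toℕ j))) (a j) λ i → sgn (toℕ i) * (b i * d i j)) ⟩
    sum (λ j → sum λ i → sgn (suc (toℕ j)) * (a j * (sgn (toℕ i) * (b i * d i j))))
      ≈⟨ ∑-comm (λ j i → sgn (suc (toℕ j)) * (a j * (sgn (toℕ i) * (b i * d i j)))) ⟩
    sum (λ i → sum λ j → sgn (suc (toℕ j)) * (a j * (sgn (toℕ i) * (b i * d i j))))
      ≈⟨ sum-cong (λ i → sum-cong λ j →
           solve 5 (λ s t a b d → (:- :1) :* s :* (a :* (t :* (b :* d))) := (:- :1) :* t :* (b :* (s :* (a :* d))))
             refl (sgn (toℕ j)) (sgn (toℕ i)) (a j) (b i) (d i j)) ⟩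
    sum (λ i → sum λ j → sgn (suc (toℕ i)) * (b i * (sgn (toℕ j) * (a j * d i j))))
      ≈⟨ sum-cong (λ i → pull (sgn (suc (toℕ i))) (b i) λ j → sgn (toℕ j) * (a j * d i j)) ⟨
    sum (λ i → sgn (suc (toℕ i)) * (b i * sum λ j → sgn (toℕ j) * (a j * d i j))) ∎)
    where
    pull : ∀ {k} x y (f : Fin k → Carrier) → x * (y * sum f) ≈ sum λ i → x * (y * f i)
    pull x y f = trans (*-congˡ (*-distribˡ-sum y f)) (*-distribˡ-sum x (λ i → y * f i))
    a : Fin (suc n) → Carrier
    a j = M zero (suc j)
    b : Fin (suc n) → Carrier
    b i = M (suc i) zero
    d : Fin (suc n) → Fin (suc n) → Carrier
    d i j = det (λ p q → M (suc (punchIn i p)) (suc (punchIn j q)))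

  det-transpose : (M : Matrix n) → det (λ i j → M j i) ≈ det M
  det-transpose {zero}  M = refl
  det-transpose {suc n} M = trans
    (sum-cong λ j → *-congˡ {sgn (toℕ j)} (*-congˡ {M j zero} (det-transpose (λ p q → M (punchIn j p) (suc q)))))
    (sym (det-first-column M))

  -- The first two terms of the expansion have equal minors and opposite signs; every later minor
  -- again begins with two equal columns.
  det-equal-columns : (M : Matrix (suc (suc n))) → (∀ i → M i zero ≈ M i (suc zero)) → det M ≈ 0#
  det-equal-columns {n} M eq = begin
    sgn 0 * (M zero zero * D₀) + (sgn 1 * (M zero (suc zero) * D₁) + rest)
      ≈⟨ +-cong (*-congˡ (*-cong (eq zero) (det-cong minors))) (+-congˡ (sum-0 (tail-vanishes n M eq))) ⟩
    sgn 0 * (M zero (suc zero) * D₁) + (sgn 1 * (M zero (suc zero) * D₁) + 0#)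
      ≈⟨ solve 2 (λ m d → :1 :* (m :* d) :+ ((:- :1) :* :1 :* (m :* d) :+ :0) := :0) refl (M zero (suc zero)) D₁ ⟩
    0# ∎
    where
    D₀ = det (λ p q → M (suc p) (suc q))
    D₁ = det (λ p q → M (suc p) (punchIn (suc zero) q))
    rest = sum λ j → sgn (suc (suc (toℕ j))) * (M zero (suc (suc j)) * det (λ p q → M (suc p) (punchIn (suc (suc j)) q)))

    minors : ∀ p q → M (suc p) (suc q) ≈ M (suc p) (punchIn (suc zero) q)
    minors p zero    = sym (eq (suc p))
    minors p (suc q) = refl

    tail-vanishes : ∀ n (M : Matrix (suc (suc n))) → (∀ i → M i zero ≈ M i (suc zero)) → ∀ j →
      sgn (suc (suc (toℕ j))) * (M zero (suc (suc j)) * det (λ p q → M (suc p) (punchIn (suc (suc j)) q))) ≈ 0#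
    tail-vanishes (suc n) M eq j = trans
      (*-congˡ (trans (*-congˡ (det-equal-columns (λ p q → M (suc p) (punchIn (suc (suc j)) q)) (eq ∘ suc))) (zeroʳ _)))
      (zeroʳ _)

  det-equal-rows : (v : Vector Carrier (suc (suc n))) (R : Fin n → Vector Carrier (suc (suc n))) →
    det (v ◂ (v ◂ R)) ≈ 0#
  det-equal-rows v R = trans (sym (det-transpose (v ◂ (v ◂ R))))
    (det-equal-columns (λ i j → (v ◂ (v ◂ R)) j i) λ i → refl)

  -- Multilinear functions of n rows vanishing on adjacent equal rows, by recursion on the first row.

  Congruent : ((Fin n → Vector Carrier m) → Carrier) → Set (c ⊔ ℓ₁)
  Congruent F = ∀ {R R′} → (∀ i j → R i j ≈ R′ i j) → F R ≈ F R′

  VanishesOnRepeat : ∀ n → ((Fin (suc n) → Vector Carrier m) → Carrier) → Set (c ⊔ ℓ₁)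
  VanishesOnRepeat zero    F = Lift _ ⊤
  VanishesOnRepeat (suc n) F = ∀ v R → F (v ◂ (v ◂ R)) ≈ 0#

  -- The number `n` of rows and their length `m` are independent, since fixing a row lowers only
  -- `n`. Congruence is demanded because rows are functions compared pointwise.
  data Alternating {m} : ∀ n → ((Fin n → Vector Carrier m) → Carrier) → Set (c ⊔ ℓ₁) where
    nil  : ∀ {F} → Congruent F → Alternating 0 F
    cons : ∀ {n F} → Congruent F →
           (∀ x u v R → F ((λ j → x * u j + v j) ◂ R) ≈ x * F (u ◂ R) + F (v ◂ R)) →
           VanishesOnRepeat n F →
           (∀ v → Alternating n (λ R → F (v ◂ R))) →
           Alternating (suc n) F

  ◂-cong : {u v : Vector Carrier m} {R R′ : Fin n → Vector Carrier m} →
    (∀ j → u j ≈ v j) → (∀ i j → R i j ≈ R′ i j) → ∀ i j → (u ◂ R) i j ≈ (v ◂ R′) i j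
  ◂-cong u≈v R≈R′ zero    = u≈v
  ◂-cong u≈v R≈R′ (suc i) = R≈R′ i

  congruent : ∀ {F : (Fin n → Vector Carrier m) → Carrier} → Alternating n F → Congruent F
  congruent (nil cong)        = cong
  congruent (cons cong _ _ _) = cong

  alternating-0 : Alternating {m} n λ _ → 0#
  alternating-0 {n = zero}        = nil λ _ → refl
  alternating-0 {n = suc zero}    = cons (λ _ → refl) (λ x _ _ _ → sym (trans (+-identityʳ _) (zeroʳ x))) (lift _) λ _ → alternating-0
  alternating-0 {n = suc (suc n)} = cons (λ _ → refl) (λ x _ _ _ → sym (trans (+-identityʳ _) (zeroʳ x))) (λ _ _ → refl) λ _ → alternating-0

  alternating-+ : ∀ {F G : (Fin n → Vector Carrier m) → Carrier} a →
    Alternating n F → Alternating n G → Alternating n (λ R → a * F R + G R)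
  alternating-+ a (nil cF) (nil cG) = nil λ e → +-cong (*-congˡ (cF e)) (cG e)
  alternating-+ {F = F} {G} a (cons {n} cF lF rF tF) (cons cG lG rG tG) =
    cons (λ e → +-cong (*-congˡ (cF e)) (cG e))
         (λ x u v R → trans (+-cong (*-congˡ (lF x u v R)) (lG x u v R))
            (solve 6 (λ a x p q r s → a :* (x :* p :+ q) :+ (x :* r :+ s) := x :* (a :* p :+ r) :+ (a :* q :+ s)) refl
               a x (F (u ◂ R)) (F (v ◂ R)) (G (u ◂ R)) (G (v ◂ R))))
         (repeats n rF rG)
         (λ v → alternating-+ a (tF v) (tG v))
    where
    repeats : ∀ n {F G} → VanishesOnRepeat n F → VanishesOnRepeat n G → VanishesOnRepeat n (λ R → a * F R + G R)
    repeats zero    _  _  = lift _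
    repeats (suc n) rF rG = λ v R → trans (+-cong (trans (*-congˡ (rF v R)) (zeroʳ a)) (rG v R)) (+-identityʳ 0#)

  alternating-resp : ∀ {F G : (Fin n → Vector Carrier m) → Carrier} →
    (∀ R → F R ≈ G R) → Alternating n F → Alternating n G
  alternating-resp F≈G (nil cF) = nil λ e → trans (sym (F≈G _)) (trans (cF e) (F≈G _))
  alternating-resp {F = F} {G} F≈G (cons {n} cF lF rF tF) =
    cons (λ e → trans (sym (F≈G _)) (trans (cF e) (F≈G _)))
         (λ x u v R → trans (sym (F≈G _)) (trans (lF x u v R) (+-cong (*-congˡ (F≈G _)) (F≈G _))))
         (repeats n F≈G rF)
         (λ v → alternating-resp (λ R → F≈G (v ◂ R)) (tF v))
    where
    repeats : ∀ n {F G} → (∀ R → F R ≈ G R) → VanishesOnRepeat n F → VanishesOnRepeat n G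
    repeats zero    _   _  = lift _
    repeats (suc n) F≈G rF = λ v R → trans (sym (F≈G _)) (rF v R)

  alternating-sum : ∀ {k} {F : Fin k → (Fin n → Vector Carrier m) → Carrier} (a : Fin k → Carrier) →
    (∀ i → Alternating n (F i)) → Alternating n (λ R → sum λ i → a i * F i R)
  alternating-sum {k = zero}  a AF = alternating-0
  alternating-sum {k = suc k} a AF = alternating-+ (a zero) (AF zero) (alternating-sum (a ∘ suc) (AF ∘ suc))

  record IsLinear {m m′} (L : Vector Carrier m → Vector Carrier m′) : Set (c ⊔ ℓ₁) where
    field
      cong   : ∀ {u v} → (∀ j → u j ≈ v j) → ∀ j → L u j ≈ L v j
      linear : ∀ x u v j → L (λ i → x * u i + v i) j ≈ x * L u j + L v j

  ∘-◂ : ∀ {m′} (L : Vector Carrier m → Vector Carrier m′) v (R : Fin n → Vector Carrier m) →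
    ∀ i j → (L v ◂ (L ∘ R)) i j ≈ L ((v ◂ R) i) j
  ∘-◂ L v R zero    j = refl
  ∘-◂ L v R (suc i) j = refl

  -- Applied with `L` deleting a column, inserting a zero column, and multiplying by a matrix on the
  -- right.
  alternating-∘ : ∀ {m′} {F : (Fin n → Vector Carrier m′) → Carrier} {L : Vector Carrier m → Vector Carrier m′} →
    IsLinear L → Alternating n F → Alternating n (λ R → F (L ∘ R))
  alternating-∘ lin (nil cF) = nil λ e → cF λ i → IsLinear.cong lin (e i)
  alternating-∘ {m = m} {F = F} {L} lin (cons {n} cF lF rF tF) =
    cons (λ e → cF λ i → IsLinear.cong lin (e i))
         (λ x u v R → trans (cF λ i j → sym (∘-◂ L _ R i j))
            (trans (cF (◂-cong (IsLinear.linear lin x u v) λ i j → refl))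
            (trans (lF x (L u) (L v) (L ∘ R)) (+-cong (*-congˡ (cF (∘-◂ L u R))) (cF (∘-◂ L v R))))))
         (repeats n cF rF)
         (λ v → alternating-resp (λ R → cF (∘-◂ L v R)) (alternating-∘ lin (tF (L v))))
    where
    repeats : ∀ n {F} → Congruent F → VanishesOnRepeat n F → VanishesOnRepeat n (λ R → F (L ∘ R))
    repeats zero    _  _  = lift _
    repeats (suc n) cF rF = λ v R → trans (cF (λ { zero j → refl ; (suc zero) j → refl ; (suc (suc i)) j → refl })) (rF (L v) (L ∘ R))

  linear-reindex : ∀ {m′} (π : Fin m′ → Fin m) → IsLinear (λ (v : Vector Carrier m) → v ∘ π)
  linear-reindex π = record { cong = λ e j → e (π j) ; linear = λ _ _ _ _ → refl }

  det-linear : ∀ x (u v : Vector Carrier (suc n)) R →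
    det ((λ j → x * u j + v j) ◂ R) ≈ x * det (u ◂ R) + det (v ◂ R)
  det-linear {n} x u v R = begin
    sum (λ j → s j * ((x * u j + v j) * d j))
      ≈⟨ sum-cong (λ j → solve 5 (λ s x u v d → s :* ((x :* u :+ v) :* d) := x :* (s :* (u :* d)) :+ s :* (v :* d))
          refl (s j) x (u j) (v j) (d j)) ⟩
    sum (λ j → x * (s j * (u j * d j)) + s j * (v j * d j))
      ≈⟨ ∑-distrib-+ (λ j → x * (s j * (u j * d j))) (λ j → s j * (v j * d j)) ⟩
    sum (λ j → x * (s j * (u j * d j))) + sum (λ j → s j * (v j * d j))
      ≈⟨ +-congʳ (*-distribˡ-sum x (λ j → s j * (u j * d j))) ⟨
    x * sum (λ j → s j * (u j * d j)) + sum (λ j → s j * (v j * d j)) ∎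
    where
    s : Fin (suc n) → Carrier
    s j = sgn (toℕ j)
    d : Fin (suc n) → Carrier
    d j = det (λ p q → R p (punchIn j q))

  det-alternating : ∀ n → Alternating n (det {n})
  det-alternating zero    = nil λ _ → refl
  det-alternating (suc n) = cons det-cong det-linear (repeats n) λ v →
    alternating-resp (λ R → sum-cong λ j → *-assoc (sgn (toℕ j)) (v j) (det λ p q → R p (punchIn j q)))
      (alternating-sum (λ j → sgn (toℕ j) * v j) λ j → alternating-∘ (linear-reindex (punchIn j)) (det-alternating n))
    where
    repeats : ∀ n → VanishesOnRepeat n (det {suc n})
    repeats zero    = lift _
    repeats (suc n) = det-equal-rows

  identity-diagonal : (i : Fin n) → identity i i ≈ 1#
  identity-diagonal i with i ≟ i
  ... | yes _   = refl
  ... | no i≢i = contradiction ≡.refl i≢i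

  identity-off-diagonal : {i j : Fin n} → i ≢ j → identity i j ≈ 0#
  identity-off-diagonal {i = i} {j} i≢j with i ≟ j
  ... | yes i≡j = contradiction i≡j i≢j
  ... | no _    = refl

  identity-injective : (f : Fin m → Fin n) → (∀ {i j} → f i ≡ f j → i ≡ j) → ∀ i j → identity i j ≈ identity (f i) (f j)
  identity-injective f f-inj i j with i ≟ j
  ... | yes ≡.refl = sym (identity-diagonal (f i))
  ... | no i≢j     = sym (identity-off-diagonal (i≢j ∘ f-inj))

  sum-identity : (i : Fin n) (f : Fin n → Carrier) → sum (λ k → identity i k * f k) ≈ f i
  sum-identity {suc n} zero f = trans
    (+-cong (*-identityˡ _) (sum-0 {n} λ k → trans (*-congʳ (identity-off-diagonal {i = zero} {suc k} λ ())) (zeroˡ _)))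
    (+-identityʳ _)
  sum-identity {suc n} (suc i) f = trans
    (+-cong (trans (*-congʳ (identity-off-diagonal {i = suc i} {zero} λ ())) (zeroˡ _))
            (trans (sum-cong λ k → *-congʳ (sym (identity-injective suc suc-injective i k))) (sum-identity i (f ∘ suc))))
    (+-identityˡ _)

  -- Exchanging rows, and uniqueness and multiplicativity of the determinant

  sgn² : ∀ k → sgn k * sgn k ≈ 1#
  sgn² zero    = *-identityˡ 1#
  sgn² (suc k) = trans (solve 1 (λ s → (:- :1) :* s :* ((:- :1) :* s) := s :* s) refl (sgn k)) (sgn² k)

  -- Polarisation: expand the vanishing value of `F` at two equal rows u + v. The factor 1 in `w`
  -- only puts u + v into the form in which linearity is stated.
  alternating-swap : {F : (Fin (suc (suc n)) → Vector Carrier m) → Carrier} → Alternating (suc (suc n)) F →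
    ∀ u v R → F (u ◂ (v ◂ R)) ≈ - F (v ◂ (u ◂ R))
  alternating-swap {m = m} {F = F} (cons _ lin repeat tail) u v R = begin
    p
      ≈⟨ solve 4 (λ p q r s → p := ((:1 :* (:1 :* r :+ p)) :+ (:1 :* q :+ s)) :+ (:- (r :+ (s :+ q)))) refl p q r s ⟩
    ((1# * (1# * r + p)) + (1# * q + s)) - (r + (s + q))
           ≈⟨ +-congʳ (+-cong (*-congˡ (lin₁ (tail u))) (lin₁ (tail v))) ⟨
    (1# * F (u ◂ (w ◂ R)) + F (v ◂ (w ◂ R))) - (r + (s + q))
           ≈⟨ +-congʳ (lin 1# u v (w ◂ R)) ⟨
    F (w ◂ (w ◂ R)) - (r + (s + q))
           ≈⟨ +-cong (repeat w R) (-‿cong (+-cong (repeat u R) (+-congʳ (repeat v R)))) ⟩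
    0# - (0# + (0# + q)) ≈⟨ solve 1 (λ q → :0 :- (:0 :+ (:0 :+ q)) := :- q) refl q ⟩
    - q ∎
    where
    w : Vector Carrier m
    w j = 1# * u j + v j
    p = F (u ◂ (v ◂ R))
    q = F (v ◂ (u ◂ R))
    r = F (u ◂ (u ◂ R))
    s = F (v ◂ (v ◂ R))
    lin₁ : ∀ {x} → Alternating _ (λ R → F (x ◂ R)) → F (x ◂ (w ◂ R)) ≈ 1# * F (x ◂ (u ◂ R)) + F (x ◂ (v ◂ R))
    lin₁ (cons _ lin _ _) = lin 1# u v R

  alternating-move : {F : (Fin (suc n) → Vector Carrier m) → Carrier} → Alternating (suc n) F →
    ∀ R j → F (R j ◂ (R ∘ punchIn j)) ≈ sgn (toℕ j) * F R
  alternating-move AF R zero = trans (congruent AF λ { zero _ → refl ; (suc i) _ → refl }) (sym (*-identityˡ _))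
  alternating-move {suc n} {F = F} AF@(cons cF _ _ tF) R (suc j) = begin
    F (R (suc j) ◂ (R ∘ punchIn (suc j)))
      ≈⟨ cF (λ { zero _ → refl ; (suc zero) _ → refl ; (suc (suc i)) _ → refl }) ⟩
    F (R (suc j) ◂ (R zero ◂ (R ∘ suc ∘ punchIn j)))
      ≈⟨ alternating-swap AF (R (suc j)) (R zero) (R ∘ suc ∘ punchIn j) ⟩
    - F (R zero ◂ (R (suc j) ◂ (R ∘ suc ∘ punchIn j)))
      ≈⟨ -‿cong (alternating-move (tF (R zero)) (R ∘ suc) j) ⟩
    - (sgn (toℕ j) * F (R zero ◂ (R ∘ suc)))
      ≈⟨ -‿cong (*-congˡ (cF λ { zero _ → refl ; (suc i) _ → refl })) ⟩
    - (sgn (toℕ j) * F R)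
      ≈⟨ solve 2 (λ s f → :- (s :* f) := (:- :1) :* s :* f) refl (sgn (toℕ j)) (F R) ⟩
    - 1# * sgn (toℕ j) * F R ∎

  -- The repeated rows need not be adjacent: row p is moved up next to the first, at the cost of a
  -- sign that squares to 1.
  alternating-equal : {F : (Fin (suc n) → Vector Carrier m) → Carrier} → Alternating (suc n) F →
    (u : Vector Carrier m) (R : Fin n → Vector Carrier m) → ∀ p → (∀ j → R p j ≈ u j) → F (u ◂ R) ≈ 0#
  alternating-equal {suc n} {F = F} (cons cF _ repeat tF) u R p Rp≈u = begin
    F (u ◂ R)                                         ≈⟨ *-identityˡ _ ⟨
    1# * F (u ◂ R)                                    ≈⟨ *-congʳ (sgn² (toℕ p)) ⟨
    sgn (toℕ p) * sgn (toℕ p) * F (u ◂ R)             ≈⟨ *-assoc _ _ _ ⟩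
    sgn (toℕ p) * (sgn (toℕ p) * F (u ◂ R))           ≈⟨ *-congˡ (alternating-move (tF u) R p) ⟨
    sgn (toℕ p) * F (u ◂ (R p ◂ (R ∘ punchIn p)))
      ≈⟨ *-congˡ (cF (◂-cong (λ _ → refl) (◂-cong Rp≈u λ _ _ → refl))) ⟩
    sgn (toℕ p) * F (u ◂ (u ◂ (R ∘ punchIn p)))       ≈⟨ *-congˡ (repeat u _) ⟩
    sgn (toℕ p) * 0#                                  ≈⟨ zeroʳ _ ⟩
    0#                                                ∎

  -- Here `u` is not among the rows. `vanish` holds when `u` is a row that `F` already has fixed,
  -- and it passes on to `F` with further rows fixed, so the rows can be treated one at a time.
  add-multiples : {F : (Fin n → Vector Carrier m) → Carrier} → Alternating n F →
    (u : Vector Carrier m) → (∀ (R : Fin n → Vector Carrier m) p → (∀ j → R p j ≈ u j) → F R ≈ 0#) →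
    (x : Fin n → Carrier) (R : Fin n → Vector Carrier m) → F (λ p j → x p * u j + R p j) ≈ F R
  add-multiples (nil cF) u vanish x R = cF λ ()
  add-multiples {F = F} (cons cF lin _ tF) u vanish x R = begin
    F R′
      ≈⟨ cF (λ { zero _ → refl ; (suc i) _ → refl }) ⟩
    F ((λ j → x zero * u j + R zero j) ◂ (R′ ∘ suc))
      ≈⟨ lin (x zero) u (R zero) (R′ ∘ suc) ⟩
    x zero * F (u ◂ (R′ ∘ suc)) + F (R zero ◂ (R′ ∘ suc))
      ≈⟨ +-cong (trans (*-congˡ (vanish (u ◂ (R′ ∘ suc)) zero λ _ → refl)) (zeroʳ _))
                (add-multiples (tF (R zero)) u (λ S p eq → vanish (R zero ◂ S) (suc p) eq) (x ∘ suc) (R ∘ suc)) ⟩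
    0# + F (R zero ◂ (R ∘ suc))
      ≈⟨ trans (+-identityˡ _) (cF λ { zero _ → refl ; (suc i) _ → refl }) ⟩
    F R ∎
    where
    R′ : Fin _ → Vector Carrier _
    R′ p j = x p * u j + R p j

  add-multiples-of-first : {F : (Fin (suc n) → Vector Carrier m) → Carrier} → Alternating (suc n) F →
    (u : Vector Carrier m) (x : Fin n → Carrier) (R : Fin n → Vector Carrier m) → F (u ◂ (λ p j → x p * u j + R p j)) ≈ F (u ◂ R)
  add-multiples-of-first AF@(cons _ _ _ tF) u = add-multiples (tF u) u (alternating-equal AF u)

  linear-expansion : (f : Vector Carrier m → Carrier) → (∀ {u v} → (∀ j → u j ≈ v j) → f u ≈ f v) →
    (∀ x u v → f (λ j → x * u j + v j) ≈ x * f u + f v) →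
    ∀ v → f v ≈ sum λ j → v j * f (identity j)
  linear-expansion {zero} f cong lin v = begin
    -- All vectors of length 0 agree, so v may be written as -v + v, and linearity then gives 0.
    f v                       ≈⟨ cong (λ ()) ⟩
    f (λ j → - 1# * v j + v j) ≈⟨ lin (- 1#) v v ⟩
    - 1# * f v + f v          ≈⟨ solve 1 (λ x → (:- :1) :* x :+ x := :0) refl (f v) ⟩
    0#                        ∎
  linear-expansion {suc m} f cong lin v = begin
    f v
      ≈⟨ cong (λ { zero → sym (trans (+-cong (*-identityʳ _) refl) (+-identityʳ _))
                 ; (suc j) → sym (trans (+-congʳ (zeroʳ _)) (+-identityˡ _)) }) ⟩
    f (λ j → v zero * identity zero j + (0# ◂ (v ∘ suc)) j)
      ≈⟨ lin (v zero) (identity zero) _ ⟩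
    v zero * f (identity zero) + f (0# ◂ (v ∘ suc))
      ≈⟨ +-congˡ (linear-expansion (λ w → f (0# ◂ w)) (λ u≈v → cong λ { zero → refl ; (suc j) → u≈v j })
           (λ x u v → trans (cong λ { zero → sym (trans (+-identityʳ _) (zeroʳ x)) ; (suc j) → refl }) (lin x (0# ◂ u) (0# ◂ v)))
           (v ∘ suc)) ⟩
    v zero * f (identity zero) + sum (λ j → v (suc j) * f (0# ◂ identity j))
      ≈⟨ +-congˡ (sum-cong λ j → *-congˡ {v (suc j)} (cong λ { zero → refl ; (suc k) → identity-injective suc suc-injective j k })) ⟩
    v zero * f (identity zero) + sum (λ j → v (suc j) * f (identity (suc j))) ∎

  alternating-expansion : {F : (Fin (suc n) → Vector Carrier m) → Carrier} → Alternating (suc n) F →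
    ∀ v R → F (v ◂ R) ≈ sum λ j → v j * F (identity j ◂ R)
  alternating-expansion {F = F} (cons cF lin _ _) v R =
    linear-expansion (λ v → F (v ◂ R)) (λ u≈v → cF (◂-cong u≈v λ _ _ → refl)) (λ x u v → lin x u v R) v

  punchIn-view : (j k : Fin (suc n)) → k ≡ j ⊎ ∃[ i ] k ≡ punchIn j i
  punchIn-view j k with j ≟ k
  ... | yes j≡k = inj₁ (≡.sym j≡k)
  ... | no  j≢k = inj₂ (punchOut j≢k , ≡.sym (punchIn-punchOut j≢k))

  insert0 : Fin (suc n) → Vector Carrier n → Vector Carrier (suc n)
  insert0 j v = insertAt v j 0#

  insert0-unique : (j : Fin (suc n)) (v : Vector Carrier n) (w : Vector Carrier (suc n)) →
    w j ≈ 0# → (∀ i → w (punchIn j i) ≈ v i) → ∀ k → w k ≈ insert0 j v k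
  insert0-unique j v w wj≈0 w≈v k with punchIn-view j k
  ... | inj₁ ≡.refl       = trans wj≈0 (reflexive (≡.sym (insertAt-lookup v j 0#)))
  ... | inj₂ (i , ≡.refl) = trans (w≈v i) (reflexive (≡.sym (insertAt-punchIn v j 0# i)))

  insert0-linear : (j : Fin (suc n)) → IsLinear (insert0 j)
  insert0-linear j = record
    { cong   = λ {u} {v} u≈v → insert0-unique j v (insert0 j u) (at-j u) (λ i → trans (at-punchIn u i) (u≈v i))
    ; linear = λ x u v k → sym (insert0-unique j (λ i → x * u i + v i) (λ k → x * insert0 j u k + insert0 j v k)
        (trans (+-cong (trans (*-congˡ (at-j u)) (zeroʳ x)) (at-j v)) (+-identityʳ 0#))
        (λ i → +-cong (*-congˡ (at-punchIn u i)) (at-punchIn v i)) k)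
    }
    where
    at-j : ∀ u → insert0 j u j ≈ 0#
    at-j u = reflexive (insertAt-lookup u j 0#)
    at-punchIn : ∀ u i → insert0 j u (punchIn j i) ≈ u i
    at-punchIn u i = reflexive (insertAt-punchIn u j 0# i)

  -- Expand the first row in unit vectors. Under a first row e_j, column j of the other rows can be
  -- cleared, so they come from a minor by inserting a zero column and the induction hypothesis
  -- applies; moving e_j back to its place in the identity yields the cofactor sign.
  alternating-unique : {F : (Fin n → Vector Carrier n) → Carrier} → Alternating n F → ∀ R → F R ≈ det R * F identity
  alternating-unique (nil cF) R = trans (cF λ ()) (sym (*-identityˡ _))
  alternating-unique {suc n} {F} AF@(cons cF _ _ tF) R = begin
    F R
      ≈⟨ cF (λ { zero _ → refl ; (suc i) _ → refl }) ⟩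
    F (R zero ◂ (R ∘ suc))
      ≈⟨ alternating-expansion AF (R zero) (R ∘ suc) ⟩
    sum (λ j → R zero j * F (identity j ◂ (R ∘ suc)))
      ≈⟨ sum-cong (λ j → trans (*-congˡ (term j))
           (solve 4 (λ r d s f → r :* (d :* (s :* f)) := (s :* (r :* d)) :* f)
               refl (R zero j) (det (minor j)) (sgn (toℕ j)) (F identity))) ⟩
    sum (λ j → sgn (toℕ j) * (R zero j * det (minor j)) * F identity)
      ≈⟨ *-distribʳ-sum (F identity) (λ j → sgn (toℕ j) * (R zero j * det (minor j))) ⟨
    det R * F identity ∎
    where
    minor : Fin (suc n) → Matrix n
    minor j p q = R (suc p) (punchIn j q)

    cleared : ∀ j p k → - R (suc p) j * identity j k + R (suc p) k ≈ insert0 j (minor j p) k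
    cleared j p = insert0-unique j (minor j p) _
      (trans (+-congʳ (*-congˡ (identity-diagonal j))) (solve 1 (λ x → (:- x) :* :1 :+ x := :0) refl (R (suc p) j)))
      (λ i → trans (+-congʳ (trans (*-congˡ (identity-off-diagonal (λ e → punchInᵢ≢i j i (≡.sym e)))) (zeroʳ _))) (+-identityˡ _))

    inserted-identity : ∀ j p k → identity (punchIn j p) k ≈ insert0 j (identity p) k
    inserted-identity j p = insert0-unique j (identity p) _
      (identity-off-diagonal (punchInᵢ≢i j p))
      (λ i → sym (identity-injective (punchIn j) (punchIn-injective j _ _) p i))

    term : ∀ j → F (identity j ◂ (R ∘ suc)) ≈ det (minor j) * (sgn (toℕ j) * F identity)
    term j = begin
      F (identity j ◂ (R ∘ suc))
        ≈⟨ add-multiples-of-first AF (identity j) (λ p → - R (suc p) j) (R ∘ suc) ⟨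
      F (identity j ◂ (λ p k → - R (suc p) j * identity j k + R (suc p) k))
        ≈⟨ cF (◂-cong (λ _ → refl) (cleared j)) ⟩
      F (identity j ◂ (insert0 j ∘ minor j))
        ≈⟨ alternating-unique (alternating-∘ (insert0-linear j) (tF (identity j))) (minor j) ⟩
      det (minor j) * F (identity j ◂ (insert0 j ∘ identity))
        ≈⟨ *-congˡ (cF (◂-cong (λ _ → refl) (inserted-identity j))) ⟨
      det (minor j) * F (identity j ◂ (identity ∘ punchIn j))
        ≈⟨ *-congˡ (alternating-move AF identity j) ⟩
      det (minor j) * (sgn (toℕ j) * F identity) ∎

  infixl 7 _·_
  _·_ : Matrix n → Matrix n → Matrix n
  (M · N) i j = sum λ k → M i k * N k j

  ·-linear : (N : Matrix n) → IsLinear (λ (v : Vector Carrier n) j → sum λ k → v k * N k j)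
  ·-linear N = record
    { cong   = λ u≈v j → sum-cong λ k → *-congʳ (u≈v k)
    ; linear = λ x u v j → begin
        sum (λ k → (x * u k + v k) * N k j)
          ≈⟨ sum-cong (λ k → solve 4 (λ x u v n → (x :* u :+ v) :* n := x :* (u :* n) :+ v :* n)
              refl x (u k) (v k) (N k j)) ⟩
        sum (λ k → x * (u k * N k j) + v k * N k j)
          ≈⟨ ∑-distrib-+ (λ k → x * (u k * N k j)) (λ k → v k * N k j) ⟩
        sum (λ k → x * (u k * N k j)) + sum (λ k → v k * N k j)
          ≈⟨ +-congʳ (*-distribˡ-sum x (λ k → u k * N k j)) ⟨
        x * sum (λ k → u k * N k j) + sum (λ k → v k * N k j) ∎
    }

  -- As a function of the rows of `M` the left side is alternating, and at the identity its value is
  -- det N.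
  det-· : (M N : Matrix n) → det (M · N) ≈ det M * det N
  det-· {n} M N = trans
    (alternating-unique (alternating-∘ (·-linear N) (det-alternating n)) M)
    (*-congˡ (det-cong λ i j → sum-identity i (λ k → N k j)))

  det-first-row : (M : Matrix (suc n)) → (∀ j → M zero j ≈ identity zero j) → det M ≈ det (λ p q → M (suc p) (suc q))
  det-first-row {n} M e = trans
    (+-cong (trans (*-identityˡ _) (trans (*-congʳ (e zero)) (*-identityˡ _)))
            (sum-0 {n} λ j → trans (*-congˡ {sgn (suc (toℕ j))} (trans (*-congʳ (e (suc j))) (zeroˡ _))) (zeroʳ _)))
    (+-identityʳ _)

  det-identity : ∀ n → det (identity {n}) ≈ 1#
  det-identity zero    = refl
  det-identity (suc n) = trans (det-first-row (identity {suc n}) λ _ → refl)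
    (trans (det-cong {n} λ p q → sym (identity-injective suc suc-injective p q)) (det-identity n))

  -- Nonnegative minors

  det-◂ : (M : Matrix (suc n)) → det (M zero ◂ (M ∘ suc)) ≈ det M
  det-◂ M = det-cong {M = M zero ◂ (M ∘ suc)} {M} λ { zero j → refl ; (suc i) j → refl }

  det-add-first-column : (M N : Matrix (suc n)) (x : Fin n → Carrier) → (∀ i → N i zero ≈ M i zero) →
    (∀ i k → N i (suc k) ≈ x k * M i zero + M i (suc k)) → det N ≈ det M
  det-add-first-column {n} M N x e₀ e = begin
    det N                                                  ≈⟨ det-transpose N ⟨
    det (λ i j → N j i)
      ≈⟨ det-cong {M = λ i j → N j i} {u ◂ (λ p j → x p * u j + M j (suc p))} (λ { zero j → e₀ j ; (suc i) j → e j i }) ⟩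
    det (u ◂ (λ p j → x p * u j + M j (suc p)))
      ≈⟨ add-multiples-of-first (det-alternating (suc n)) u x (λ p j → M j (suc p)) ⟩
    det (u ◂ (λ p j → M j (suc p)))                        ≈⟨ det-◂ (λ i j → M j i) ⟩
    det (λ i j → M j i)                                    ≈⟨ det-transpose M ⟩
    det M                                                  ∎
    where
    u : Vector Carrier (suc n)
    u j = M j zero

  restrict : Subset n → Vector Carrier n → Vector Carrier n
  restrict S v j = if lookup S j then v j else 0#

  -- The rows outside S are unit vectors, so the determinant is the principal minor on S.
  record IsRestrictedMMatrix (S : Subset n) (M : Matrix n) : Set (c ⊔ ℓ₁ ⊔ ℓ₂) where
    field
      outside      : ∀ i → lookup S i ≡ false → ∀ j → M i j ≈ identity i j
      off-diagonal : ∀ i j → lookup S i ≡ true → i ≢ j → M i j ≤ 0#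
      row-sum      : ∀ i → lookup S i ≡ true → 0# ≤ sum (restrict S (M i))

  restrict-≤ : (S : Subset n) (v : Vector Carrier n) → ∀ j → v j ≤ 0# → restrict S v j ≤ 0#
  restrict-≤ S v j v≤0 = go (lookup S j)
    where
    go : ∀ b → (if b then v j else 0#) ≤ 0#
    go true  = v≤0
    go false = ≤-refl

  -- Contracting the first index into q: column q absorbs the first column, so row sums are kept and the signs survive.
  contract : Matrix (suc n) → Fin n → Matrix n
  contract M q p k = identity q k * M (suc p) zero + M (suc p) (suc k)

  -- Write e_(q+1) as e_0 - (e_0 - e_(q+1)). Adding the first column to column q+1 turns the row e_0
  -- - e_(q+1) into e_0, and the minor that is left is the contraction.
  det-contract : (M : Matrix (suc n)) (q : Fin n) →
    det (identity (suc q) ◂ (M ∘ suc)) ≈ det (identity zero ◂ (M ∘ suc)) - det (contract M q)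
  det-contract {n} M q = begin
    ℓ (identity (suc q))
      ≈⟨ solve 2 (λ a b → a := b :- ((:- :1) :* a :+ b)) refl (ℓ (identity (suc q))) (ℓ (identity zero)) ⟩
    ℓ (identity zero) - (- 1# * ℓ (identity (suc q)) + ℓ (identity zero))
      ≈⟨ +-congˡ (-‿cong (det-linear (- 1#) (identity (suc q)) (identity zero) (M ∘ suc))) ⟨
    ℓ (identity zero) - det W
      ≈⟨ +-congˡ (-‿cong (det-add-first-column W W′ (identity q) (λ { zero → at-0 ; (suc i) → refl }) (λ { zero k → at-suc k ; (suc i) k → refl }))) ⟨
    ℓ (identity zero) - det W′
      ≈⟨ +-congˡ (-‿cong (det-first-row W′ λ _ → refl)) ⟩
    ℓ (identity zero) - det (contract M q) ∎
    where
    ℓ : Vector Carrier (suc n) → Carrier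
    ℓ v = det (v ◂ (M ∘ suc))
    w : Vector Carrier (suc n)
    w j = - 1# * identity (suc q) j + identity zero j
    W W′ : Matrix (suc n)
    W = w ◂ (M ∘ suc)
    W′ = identity zero ◂ λ p → M (suc p) zero ◂ contract M q p
    at-0 : 1# ≈ - 1# * 0# + 1#
    at-0 = solve 0 (:1 := (:- :1) :* :0 :+ :1) refl
    at-suc : ∀ k → 0# ≈ identity q k * (- 1# * 0# + 1#) + (- 1# * identity (suc q) (suc k) + 0#)
    at-suc k = trans (solve 1 (λ x → :0 := x :* ((:- :1) :* :0 :+ :1) :+ ((:- :1) :* x :+ :0)) refl (identity q k))
      (+-congˡ (+-congʳ (*-congˡ (identity-injective suc suc-injective q k))))

  -- Dropping a nonpositive off-diagonal entry can only raise a row sum.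
  minor-isRestrictedMMatrix : ∀ {s} {S : Subset n} {M} → IsRestrictedMMatrix (s ∷ S) M →
    IsRestrictedMMatrix S (λ p q → M (suc p) (suc q))
  minor-isRestrictedMMatrix {s = s} {S} {M} isM = record
    { outside      = λ i i∉S j → trans (outside (suc i) i∉S (suc j)) (sym (identity-injective suc suc-injective i j))
    ; off-diagonal = λ i j i∈S i≢j → off-diagonal (suc i) (suc j) i∈S (i≢j ∘ suc-injective)
    ; row-sum      = λ i i∈S → ≤-trans (row-sum (suc i) i∈S) (≤-by
        (x≤0⇒0≤-x (restrict-≤ (s ∷ S) (M (suc i)) zero (off-diagonal (suc i) zero i∈S λ ())))
        (solve 2 (λ a b → b :- (a :+ b) := :- a) refl (restrict (s ∷ S) (M (suc i)) zero) _))
    }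
    where open IsRestrictedMMatrix isM

  contract-isRestrictedMMatrix : {S : Subset n} {M : Matrix (suc n)} → IsRestrictedMMatrix (true ∷ S) M →
    ∀ q → lookup S q ≡ true → IsRestrictedMMatrix S (contract M q)
  contract-isRestrictedMMatrix {n} {S} {M} isM q q∈S = record
    { outside      = λ i i∉S j → trans
        (+-cong (trans (*-congˡ (outside (suc i) i∉S zero)) (zeroʳ _)) (outside (suc i) i∉S (suc j)))
        (trans (+-identityˡ _) (sym (identity-injective suc suc-injective i j)))
    ; off-diagonal = λ i j i∈S i≢j → ≤-by
        (0≤x+y (0≤x*y (identity-nonneg q j) (x≤0⇒0≤-x (off-diagonal (suc i) zero i∈S λ ())))
               (x≤0⇒0≤-x (off-diagonal (suc i) (suc j) i∈S (i≢j ∘ suc-injective))))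
        (solve 3 (λ d a b → :0 :- (d :* a :+ b) := d :* (:- a) :+ (:- b))
            refl (identity q j) (M (suc i) zero) (M (suc i) (suc j)))
    ; row-sum      = λ i i∈S → ≤-respʳ (sum-contract i) (row-sum (suc i) i∈S)
    }
    where
    open IsRestrictedMMatrix isM

    identity-nonneg : ∀ i j → 0# ≤ identity {n} i j
    identity-nonneg i j with i ≟ j
    ... | yes _ = 0≤1
    ... | no  _ = ≤-refl

    sum-contract : ∀ i → M (suc i) zero + sum (restrict S (λ k → M (suc i) (suc k))) ≈ sum (restrict S (contract M q i))
    sum-contract i = begin
      M (suc i) zero + sum (restrict S (λ k → M (suc i) (suc k)))
        -- As q lies in `S`, the entry moved into column q is still counted by the restricted sum.
        ≡⟨ ≡.cong (λ b → (if b then M (suc i) zero else 0#) + sum (restrict S (λ k → M (suc i) (suc k)))) (≡.sym q∈S) ⟩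
      restrict S (λ _ → M (suc i) zero) q + sum (restrict S (λ k → M (suc i) (suc k)))
        ≈⟨ +-congʳ (sum-identity q (restrict S (λ _ → M (suc i) zero))) ⟨
      sum (λ k → identity q k * restrict S (λ _ → M (suc i) zero) k) + sum (restrict S (λ k → M (suc i) (suc k)))
        ≈⟨ ∑-distrib-+ (λ k → identity q k * restrict S (λ _ → M (suc i) zero) k) (restrict S (λ k → M (suc i) (suc k))) ⟨
      sum (λ k → identity q k * restrict S (λ _ → M (suc i) zero) k + restrict S (λ k → M (suc i) (suc k)) k)
        ≈⟨ sum-cong (λ k → merge (lookup S k) (identity q k) (M (suc i) zero) (M (suc i) (suc k))) ⟩
      sum (restrict S (contract M q i)) ∎
      where
      merge : ∀ b d x y → d * (if b then x else 0#) + (if b then y else 0#) ≈ (if b then d * x + y else 0#)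
      merge true  d x y = refl
      merge false d x y = trans (+-identityʳ _) (zeroʳ d)

  -- Expand along row 0 in the basis e₀, e₀ - e_q: the coefficients are the row sum and the nonnegative -M₀q, and the
  -- determinants are those of the minor and of the contractions.
  det-nonneg : (S : Subset n) (M : Matrix n) → IsRestrictedMMatrix S M → 0# ≤ det M
  det-nonneg []         M isM = 0≤1
  det-nonneg {suc n} (false ∷ S) M isM = ≤-respʳ (sym (det-first-row M (IsRestrictedMMatrix.outside isM zero ≡.refl)))
    (det-nonneg S _ (minor-isRestrictedMMatrix isM))
  det-nonneg {suc n} (true ∷ S) M isM = ≤-trans (0≤x*y (row-sum zero ≡.refl) 0≤P) (≤-respˡ (sym expand-sum) (≤-respʳ (sym expand-det)
    (+-mono-≤ ≤-refl (sum-mono λ q → bound q (lookup S q) ≡.refl))))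
    where
    open IsRestrictedMMatrix isM
    ℓ : Vector Carrier (suc n) → Carrier
    ℓ v = det (v ◂ (M ∘ suc))
    P = det (λ p q → M (suc p) (suc q))
    ℓ₀ : ℓ (identity zero) ≈ P
    ℓ₀ = det-first-row (identity zero ◂ (M ∘ suc)) λ _ → refl
    0≤P : 0# ≤ P
    0≤P = det-nonneg S _ (minor-isRestrictedMMatrix isM)
    tail : Vector Carrier n
    tail = restrict S (λ q → M zero (suc q))

    expand-sum : (M zero zero + sum tail) * P ≈ M zero zero * P + sum (λ q → tail q * P)
    expand-sum = trans (distribʳ P _ _) (+-congˡ (*-distribʳ-sum P tail))

    expand-det : det M ≈ M zero zero * P + sum (λ q → M zero (suc q) * ℓ (identity (suc q)))
    expand-det = begin
      det M                     ≈⟨ det-◂ M ⟨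
      ℓ (M zero)                ≈⟨ alternating-expansion (det-alternating (suc n)) (M zero) (M ∘ suc) ⟩
      M zero zero * ℓ (identity zero) + sum (λ q → M zero (suc q) * ℓ (identity (suc q)))
                                ≈⟨ +-congʳ (*-congˡ ℓ₀) ⟩
      M zero zero * P + sum (λ q → M zero (suc q) * ℓ (identity (suc q))) ∎

    bound : ∀ q b → lookup S q ≡ b → (if b then M zero (suc q) else 0#) * P ≤ M zero (suc q) * ℓ (identity (suc q))
    bound q true q∈S = ≤-by
      (0≤x*y (x≤0⇒0≤-x (off-diagonal zero (suc q) ≡.refl λ ())) (det-nonneg S _ (contract-isRestrictedMMatrix isM q q∈S)))
      (trans (+-congʳ (*-congˡ (trans (det-contract M q) (+-congʳ ℓ₀))))
        (solve 3 (λ a p k → a :* (p :- k) :- a :* p := (:- a) :* k) refl (M zero (suc q)) P (det (contract M q))))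
    -- Row q+1 lies outside `S` and equals the unit vector put in the first row, so the determinant
    -- vanishes.
    bound q false q∉S = ≤-reflexive (trans (zeroˡ P) (sym (trans
      (*-congˡ (alternating-equal (det-alternating (suc n)) (identity (suc q)) (M ∘ suc) q (outside (suc q) q∉S)))
      (zeroʳ _))))

  -- Characteristic polynomials

  pencil : (Fin n → Vector Carrier m) → (Fin n → Vector Carrier m) → Carrier → Fin n → Vector Carrier m
  pencil u v x i j = x * u i j + v i j

  -- The polynomial x ↦ F (x u + v): each row comes from `u`, raising the degree by one, or from
  -- `v`. Thus coefficient k is the sum of the values of `F` over the choices with exactly k rows
  -- from `u`.
  expand : ((Fin n → Vector Carrier m) → Carrier) → (u v : Fin n → Vector Carrier m) → Polynomial
  expand {zero}  F u v = F v ∷ []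
  expand {suc n} F u v = (0# ∷ expand (λ R → F (u zero ◂ R)) (u ∘ suc) (v ∘ suc)) ⊕ expand (λ R → F (v zero ◂ R)) (u ∘ suc) (v ∘ suc)

  eval-expand : {F : (Fin n → Vector Carrier m) → Carrier} → Alternating n F → ∀ u v x →
    eval (expand F u v) x ≈ F (pencil u v x)
  eval-expand (nil cF) u v x = trans (trans (+-congˡ (zeroʳ x)) (+-identityʳ _)) (cF λ ())
  eval-expand {suc n} {F = F} (cons cF lin _ tF) u v x = begin
    eval ((0# ∷ p) ⊕ q) x                      ≈⟨ eval-⊕ (0# ∷ p) q x ⟩
    0# + x * eval p x + eval q x
      ≈⟨ +-cong (trans (+-identityˡ _) (*-congˡ (eval-expand (tF (u zero)) u′ v′ x))) (eval-expand (tF (v zero)) u′ v′ x) ⟩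
    x * F (u zero ◂ pencil u′ v′ x) + F (v zero ◂ pencil u′ v′ x)
                                               ≈⟨ lin x (u zero) (v zero) (pencil u′ v′ x) ⟨
    F (pencil u v x zero ◂ pencil u′ v′ x)     ≈⟨ cF (λ { zero _ → refl ; (suc i) _ → refl }) ⟩
    F (pencil u v x)                           ∎
    where
    u′ = u ∘ suc
    v′ = v ∘ suc
    p = expand (λ R → F (u zero ◂ R)) u′ v′
    q = expand (λ R → F (v zero ◂ R)) u′ v′

  expand-degree : (F : (Fin n → Vector Carrier m) → Carrier) → ∀ u v k → n ℕ.< k → coeff k (expand F u v) ≈ 0#
  expand-degree {zero}  F u v (suc k) n<k       = refl
  expand-degree {suc n} F u v (suc k) (s≤s n<k) = begin
    coeff (suc k) ((0# ∷ p) ⊕ q)    ≈⟨ coeff-⊕ (suc k) (0# ∷ p) q ⟩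
    coeff k p + coeff (suc k) q
      ≈⟨ +-cong (expand-degree (λ R → F (u zero ◂ R)) _ _ k n<k) (expand-degree (λ R → F (v zero ◂ R)) _ _ (suc k) (ℕ.m<n⇒m<1+n n<k)) ⟩
    0# + 0#                         ≈⟨ +-identityʳ 0# ⟩
    0#                              ∎
    where
    p = expand (λ R → F (u zero ◂ R)) (u ∘ suc) (v ∘ suc)
    q = expand (λ R → F (v zero ◂ R)) (u ∘ suc) (v ∘ suc)

  expand-leading : {F : (Fin n → Vector Carrier m) → Carrier} → Alternating n F → ∀ u v → coeff n (expand F u v) ≈ F u
  expand-leading (nil cF) u v = cF λ ()
  expand-leading {suc n} {F = F} (cons cF _ _ tF) u v = begin
    coeff (suc n) ((0# ∷ p) ⊕ q)    ≈⟨ coeff-⊕ (suc n) (0# ∷ p) q ⟩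
    coeff n p + coeff (suc n) q
      ≈⟨ +-cong (expand-leading (tF (u zero)) _ _) (expand-degree (λ R → F (v zero ◂ R)) _ _ (suc n) (ℕ.n<1+n n)) ⟩
    F (u zero ◂ (u ∘ suc)) + 0#     ≈⟨ trans (+-identityʳ _) (cF λ { zero _ → refl ; (suc i) _ → refl }) ⟩
    F u                             ∎
    where
    p = expand (λ R → F (u zero ◂ R)) (u ∘ suc) (v ∘ suc)
    q = expand (λ R → F (v zero ◂ R)) (u ∘ suc) (v ∘ suc)

  replace : Fin n → (u v : Fin n → Vector Carrier m) → Fin n → Vector Carrier m
  replace zero    u v = v zero ◂ (u ∘ suc)
  replace (suc i) u v = u zero ◂ replace i (u ∘ suc) (v ∘ suc)

  -- Degree n - 1 comes from the choices with a single row from `v`. As for `fromRoots`, the extra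
  -- factor x covers n = 0.
  expand-subleading : {F : (Fin n → Vector Carrier m) → Carrier} → Alternating n F → ∀ u v →
    coeff n (0# ∷ expand F u v) ≈ sum λ i → F (replace i u v)
  expand-subleading (nil cF) u v = refl
  expand-subleading {suc n} {F = F} (cons cF _ _ tF) u v = begin
    coeff n ((0# ∷ p) ⊕ q)          ≈⟨ coeff-⊕ n (0# ∷ p) q ⟩
    coeff n (0# ∷ p) + coeff n q    ≈⟨ +-cong (expand-subleading (tF (u zero)) _ _) (expand-leading (tF (v zero)) _ _) ⟩
    sum (λ i → F (replace (suc i) u v)) + F (replace zero u v)   ≈⟨ +-comm _ _ ⟩
    F (replace zero u v) + sum (λ i → F (replace (suc i) u v))   ∎
    where
    p = expand (λ R → F (u zero ◂ R)) (u ∘ suc) (v ∘ suc)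
    q = expand (λ R → F (v zero ◂ R)) (u ∘ suc) (v ∘ suc)

  select : Subset n → (u v : Fin n → Vector Carrier m) → Fin n → Vector Carrier m
  select []          u v = v
  select (true  ∷ S) u v = v zero ◂ select S (u ∘ suc) (v ∘ suc)
  select (false ∷ S) u v = u zero ◂ select S (u ∘ suc) (v ∘ suc)

  select-inside : (S : Subset n) (u v : Fin n → Vector Carrier m) → ∀ i → lookup S i ≡ true → select S u v i ≡ v i
  select-inside (true ∷ S)  u v zero    e = ≡.refl
  select-inside (true ∷ S)  u v (suc i) e = select-inside S _ _ i e
  select-inside (false ∷ S) u v (suc i) e = select-inside S _ _ i e

  select-outside : (S : Subset n) (u v : Fin n → Vector Carrier m) → ∀ i → lookup S i ≡ false → select S u v i ≡ u i
  select-outside (false ∷ S) u v zero    e = ≡.refl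
  select-outside (true ∷ S)  u v (suc i) e = select-outside S _ _ i e
  select-outside (false ∷ S) u v (suc i) e = select-outside S _ _ i e

  -- Degree at least j means at least j rows from `u`, so at most n - j from `v`; the set `S` lists
  -- the latter.
  expand-nonneg : (F : (Fin n → Vector Carrier m) → Carrier) (u v : Fin n → Vector Carrier m) → ∀ j →
    (∀ S → ∣ S ∣ ℕ.+ j ℕ.≤ n → 0# ≤ F (select S u v)) → ∀ k → j ℕ.≤ k → 0# ≤ coeff k (expand F u v)
  expand-nonneg {zero}  F u v zero    0≤F zero    j≤k = 0≤F [] z≤n
  expand-nonneg {zero}  F u v j       0≤F (suc k) j≤k = ≤-refl
  expand-nonneg {suc n} F u v j 0≤F k j≤k =
    ≤-respʳ (sym (coeff-⊕ k (0# ∷ p) q)) (0≤x+y (shifted j k 0≤F j≤k)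
      (expand-nonneg (λ R → F (v zero ◂ R)) _ _ j (λ S le → 0≤F (true ∷ S) (s≤s le)) k j≤k))
    where
    p = expand (λ R → F (u zero ◂ R)) (u ∘ suc) (v ∘ suc)
    q = expand (λ R → F (v zero ◂ R)) (u ∘ suc) (v ∘ suc)
    shifted : ∀ j k → (∀ S → ∣ S ∣ ℕ.+ j ℕ.≤ suc n → 0# ≤ F (select S u v)) → j ℕ.≤ k → 0# ≤ coeff k (0# ∷ p)
    shifted j       zero    0≤F j≤k       = ≤-refl
    shifted zero    (suc k) 0≤F j≤k       =
      expand-nonneg (λ R → F (u zero ◂ R)) _ _ zero (λ S le → 0≤F (false ∷ S) (ℕ.m≤n⇒m≤1+n le)) k z≤n
    shifted (suc j) (suc k) 0≤F (s≤s j≤k) =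
      expand-nonneg (λ R → F (u zero ◂ R)) _ _ j (λ S le → 0≤F (false ∷ S) (ℕ.≤-trans (ℕ.≤-reflexive (ℕ.+-suc ∣ S ∣ j)) (s≤s le))) k j≤k

  product-cong : {f g : Fin n → Carrier} → (∀ i → f i ≈ g i) → product f ≈ product g
  product-cong {zero}  f≈g = refl
  product-cong {suc n} f≈g = *-cong (f≈g zero) (product-cong (f≈g ∘ suc))

  HasRoots : Matrix n → Vector Carrier n → Set (c ⊔ ℓ₁)
  HasRoots M ev = ∀ x → charPoly M x ≈ product (λ i → x - ev i)

  charPolynomial : Matrix n → Polynomial
  charPolynomial M = expand det identity (λ i j → - M i j)

  eval-charPolynomial : (M : Matrix n) → ∀ x → eval (charPolynomial M) x ≈ charPoly M x
  eval-charPolynomial {n} M = eval-expand (det-alternating n) identity (λ i j → - M i j)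

  -- With T = cI - M, the polynomial det (xI + T) has the roots λ_i - c, and its coefficients are
  -- sums of principal minors of T. If λ_j exceeded c, the roots 0, ..., j would all be positive,
  -- one more than Descartes' rule permits.
  eigenvalue≤-by-minors : ∀ c (M : Matrix n) (ev : Vector Carrier n) → (∀ {i j} → i Fin.≤ j → ev j ≤ ev i) → HasRoots M ev → ∀ j →
    (∀ S → ∣ S ∣ ℕ.+ toℕ j ℕ.≤ n → IsRestrictedMMatrix S (select S identity (λ i k → c * identity i k - M i k))) →
    ev j ≤ c
  eigenvalue≤-by-minors {suc n} c M ev ev-mono roots j isM c<evj =
    descartes (toℕ j) p r p-roots
      (expand-nonneg det identity T (toℕ j) (λ S le → det-nonneg S _ (isM S le)))
      (r zero + 1#) (λ i → ≤-<-trans (≤-by (x≤y⇒0≤y-x (ev-mono {zero} {i} z≤n))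
          (solve 3 (λ x y c → x :- c :- (y :- c) := x :- y) refl (ev zero) (ev i) c)) (x<x+1 _))
      (toℕ<n j) (λ i i≤j → x<y⇒0<y-x (<-≤-trans c<evj (ev-mono i≤j)))
    where
    T : Matrix (suc n)
    T i k = c * identity i k - M i k
    r : Vector Carrier (suc n)
    r i = ev i - c
    p = expand det identity T
    p-roots : ∀ x → eval p x ≈ product (λ i → x - r i)
    p-roots x = begin
      eval p x                          ≈⟨ eval-expand (det-alternating (suc n)) identity T x ⟩
      det (pencil identity T x)
        ≈⟨ det-cong {M = pencil identity T x} {λ i k → (x + c) * identity i k - M i k} (λ i k →
             solve 4 (λ x c d m → x :* d :+ (c :* d :- m) := (x :+ c) :* d :- m) refl x c (identity i k) (M i k)) ⟩
      charPoly M (x + c)                ≈⟨ roots (x + c) ⟩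
      product (λ i → x + c - ev i)
        ≈⟨ product-cong (λ i → solve 3 (λ x c e → x :+ c :- e := x :- (e :- c)) refl x c (ev i)) ⟩
      product (λ i → x - r i)           ∎

  replace-∘ : ∀ {m′} (L : Vector Carrier m → Vector Carrier m′) (i : Fin n) {u v : Fin n → Vector Carrier m} {u′ v′ : Fin n → Vector Carrier m′} →
    (∀ p q → L (u p) q ≈ u′ p q) → (∀ p q → L (v p) q ≈ v′ p q) → ∀ p q → L (replace i u v p) q ≈ replace i u′ v′ p q
  replace-∘ L zero    eu ev zero    = ev zero
  replace-∘ L zero    eu ev (suc p) = eu (suc p)
  replace-∘ L (suc i) eu ev zero    = eu zero
  replace-∘ L (suc i) eu ev (suc p) = replace-∘ L i (eu ∘ suc) (ev ∘ suc) p

  -- Expanded in unit vectors, the replaced row contributes only its diagonal entry: any other unit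
  -- vector repeats a row of the identity.
  det-replace : (i : Fin n) (v : Matrix n) → det (replace i identity v) ≈ v i i
  det-replace {suc n} zero v = begin
    det (v zero ◂ R)
      ≈⟨ alternating-expansion (det-alternating (suc n)) (v zero) R ⟩
    v zero zero * det (identity {suc n} zero ◂ R) + sum (λ j → v zero (suc j) * det (R j ◂ R))
      ≈⟨ +-cong (trans (*-congˡ (trans (det-◂ (identity {suc n})) (det-identity (suc n)))) (*-identityʳ _))
           (sum-0 {n} λ j → trans (*-congˡ (alternating-equal (det-alternating (suc n)) (R j) R j λ _ → refl)) (zeroʳ _)) ⟩
    v zero zero + 0#
      ≈⟨ +-identityʳ _ ⟩
    v zero zero ∎
    where
    R : Fin n → Vector Carrier (suc n)
    R j = identity (suc j)
  det-replace {suc n} (suc i) v = begin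
    det (replace (suc i) identity v)
      ≈⟨ det-first-row (replace (suc i) identity v) (λ _ → refl) ⟩
    det (λ p q → replace i (identity ∘ suc) (v ∘ suc) p (suc q))
      ≈⟨ det-cong (replace-∘ (_∘ suc) i (λ p q → sym (identity-injective suc suc-injective p q)) (λ p q → refl)) ⟩
    det (replace i identity (λ p q → v (suc p) (suc q)))
      ≈⟨ det-replace i (λ p q → v (suc p) (suc q)) ⟩
    v (suc i) (suc i) ∎

  sum-neg : (f : Fin n → Carrier) → sum (λ i → - f i) ≈ - sum f
  sum-neg f = begin
    sum (λ i → - f i)        ≈⟨ sum-cong (λ i → solve 1 (λ x → :- x := (:- :1) :* x) refl (f i)) ⟩
    sum (λ i → - 1# * f i)   ≈⟨ *-distribˡ-sum (- 1#) f ⟨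
    - 1# * sum f             ≈⟨ solve 1 (λ x → (:- :1) :* x := :- x) refl (sum f) ⟩
    - sum f                  ∎

  trace : Matrix n → Carrier
  trace M = sum λ i → M i i

  -- Vieta's formula: both sides are minus the subleading coefficient of the characteristic
  -- polynomial.
  trace-roots : (M : Matrix n) (ev : Vector Carrier n) → HasRoots M ev → trace M ≈ sum ev
  trace-roots {n} M ev roots = begin
    trace M                                       ≈⟨ solve 1 (λ x → x := :- (:- x)) refl (trace M) ⟩
    - - trace M                                   ≈⟨ -‿cong (sum-neg λ i → M i i) ⟨
    - sum (λ i → - M i i)                         ≈⟨ -‿cong (sum-cong λ i → det-replace i (λ p q → - M p q)) ⟨
    - sum (λ i → det (replace i identity (λ p q → - M p q)))
                                                  ≈⟨ -‿cong (expand-subleading (det-alternating n) identity (λ p q → - M p q)) ⟨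
    - coeff n (0# ∷ charPolynomial M)             ≈⟨ -‿cong (coeff-≈ n) ⟩
    - coeff n (0# ∷ fromRoots ev)                 ≈⟨ -‿cong (fromRoots-subleading ev) ⟩
    - - sum ev                                    ≈⟨ solve 1 (λ x → :- (:- x) := x) refl (sum ev) ⟩
    sum ev                                        ∎
    where
    coeff-≈ : ∀ k → coeff k (0# ∷ charPolynomial M) ≈ coeff k (0# ∷ fromRoots ev)
    coeff-≈ zero    = refl
    coeff-≈ (suc k) = coeff-unique U U-unbounded (charPolynomial M) (fromRoots ev) 0# (λ x _ _ →
      trans (eval-charPolynomial M x) (trans (roots x) (sym (eval-fromRoots ev x)))) k

  -- The Rayleigh bound

  det-neg : (M : Matrix n) → det (λ i j → - M i j) ≈ sgn n * det M
  det-neg {zero}  M = sym (*-identityˡ _)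
  det-neg {suc n} M = begin
    sum (λ j → sgn (toℕ j) * (- M zero j * det (λ p q → - minor j p q)))
      ≈⟨ sum-cong (λ j → trans (*-congˡ {sgn (toℕ j)} (*-congˡ { - M zero j} (det-neg (minor j))))
           (solve 4 (λ s m t d → s :* ((:- m) :* (t :* d)) := (:- :1) :* t :* (s :* (m :* d))) refl
              (sgn (toℕ j)) (M zero j) (sgn n) (det (minor j)))) ⟩
    sum (λ j → sgn (suc n) * (sgn (toℕ j) * (M zero j * det (minor j))))
      ≈⟨ *-distribˡ-sum (sgn (suc n)) (λ j → sgn (toℕ j) * (M zero j * det (minor j))) ⟨
    sgn (suc n) * det M ∎
    where
    minor : Fin (suc n) → Matrix n
    minor j p q = M (suc p) (punchIn j q)

  product-neg : (f : Fin n → Carrier) → sgn n * product (λ i → - f i) ≈ product f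
  product-neg {zero}  f = *-identityˡ _
  product-neg {suc n} f = trans
    (solve 3 (λ s x p → (:- :1) :* s :* ((:- x) :* p) := x :* (s :* p))
        refl (sgn n) (f zero) (product (λ i → - f (suc i))))
    (*-congˡ (product-neg (f ∘ suc)))

  product-* : (f g : Fin n → Carrier) → product f * product g ≈ product (λ i → f i * g i)
  product-* {zero}  f g = *-identityˡ _
  product-* {suc n} f g = trans
    (solve 4 (λ x p y q → x :* p :* (y :* q) := x :* y :* (p :* q))
        refl (f zero) (product (f ∘ suc)) (g zero) (product (g ∘ suc)))
    (*-congˡ (product-* (f ∘ suc) (g ∘ suc)))

  identity-sym : (i j : Fin n) → identity i j ≈ identity j i
  identity-sym i j with i ≟ j
  ... | yes ≡.refl = sym (identity-diagonal i)
  ... | no i≢j     = sym (identity-off-diagonal (i≢j ∘ ≡.sym))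

  -- det (x² - M²) = det (x - M) det (x + M), which gives the characteristic polynomial of M² at squares only.
  square-roots-at-squares : (M : Matrix n) (ev : Vector Carrier n) → HasRoots M ev → ∀ x →
    charPoly (M · M) (x * x) ≈ product (λ i → x * x - ev i * ev i)
  square-roots-at-squares {n} M ev roots x = begin
    det (λ i j → x * x * identity i j - (M · M) i j)
      ≈⟨ det-cong {M = λ i j → x * x * identity i j - (M · M) i j} {N = xI-M · xI+M} (λ i j → sym (entries i j)) ⟩
    det (xI-M · xI+M)
      ≈⟨ det-· xI-M xI+M ⟩
    charPoly M x * det xI+M
      ≈⟨ *-cong (roots x) det-xI+M ⟩
    product (λ i → x - ev i) * product (λ i → x + ev i)
      ≈⟨ product-* (λ i → x - ev i) (λ i → x + ev i) ⟩
    product (λ i → (x - ev i) * (x + ev i))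
      ≈⟨ product-cong (λ i → solve 2 (λ x e → (x :- e) :* (x :+ e) := x :* x :- e :* e) refl x (ev i)) ⟩
    product (λ i → x * x - ev i * ev i) ∎
    where
    xI-M xI+M : Matrix n
    xI-M i j = x * identity i j - M i j
    xI+M i j = x * identity i j + M i j

    entries : ∀ i j → (xI-M · xI+M) i j ≈ x * x * identity i j - (M · M) i j
    entries i j = begin
      sum (λ k → (x * identity i k - M i k) * (x * identity k j + M k j))
        ≈⟨ sum-cong (λ k → trans (*-congˡ (+-congʳ (*-congˡ (identity-sym k j))))
             (solve 5 (λ x d m e l → (x :* d :- m) :* (x :* e :+ l) :=
                d :* (x :* (x :* e :+ l)) :+ (e :* (:- (x :* m)) :+ (:- (m :* l)))) refl
                x (identity i k) (M i k) (identity j k) (M k j))) ⟩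
      sum (λ k → identity i k * f k + (identity j k * g k + - (M i k * M k j)))
        ≈⟨ ∑-distrib-+ (λ k → identity i k * f k) (λ k → identity j k * g k + - (M i k * M k j)) ⟩
      sum (λ k → identity i k * f k) + sum (λ k → identity j k * g k + - (M i k * M k j))
        ≈⟨ +-cong (sum-identity i f) (trans (∑-distrib-+ (λ k → identity j k * g k) (λ k → - (M i k * M k j)))
             (+-cong (sum-identity j g) (sum-neg λ k → M i k * M k j))) ⟩
      f i + (g j + - (M · M) i j)
        ≈⟨ +-congʳ (*-congˡ (+-congʳ (*-congˡ (identity-sym j i)))) ⟩
      x * (x * identity i j + M i j) + (- (x * M i j) + - (M · M) i j)
        ≈⟨ solve 4 (λ x d m s → x :* (x :* d :+ m) :+ ((:- (x :* m)) :+ (:- s)) := x :* x :* d :- s)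
            refl x (identity i j) (M i j) ((M · M) i j) ⟩
      x * x * identity i j - (M · M) i j ∎
      where
      f g : Fin n → Carrier
      f k = x * (x * identity j k + M k j)
      g k = - (x * M i k)

    det-xI+M : det xI+M ≈ product (λ i → x + ev i)
    det-xI+M = begin
      det xI+M
        ≈⟨ det-cong {M = xI+M} {N = λ i j → - (- x * identity i j - M i j)}
             (λ i j → solve 3 (λ x d m → x :* d :+ m := :- ((:- x) :* d :- m)) refl x (identity i j) (M i j)) ⟩
      det (λ i j → - (- x * identity i j - M i j))
        ≈⟨ det-neg (λ i j → - x * identity i j - M i j) ⟩
      sgn n * charPoly M (- x)
        ≈⟨ *-congˡ (roots (- x)) ⟩
      sgn n * product (λ i → - x - ev i)
        ≈⟨ *-congˡ (product-cong λ i → solve 2 (λ x e → (:- x) :- e := :- (x :+ e)) refl x (ev i)) ⟩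
      sgn n * product (λ i → - (x + ev i))
        ≈⟨ product-neg (λ i → x + ev i) ⟩
      product (λ i → x + ev i) ∎

  IsSquare : Carrier → Set (c ⊔ ℓ₁)
  IsSquare y = ∃[ x ] y ≈ x * x

  squares-unbounded : ∀ y → ∃[ x ] y < x × IsSquare x
  squares-unbounded y = ⟦ suc h ⟧ * ⟦ suc h ⟧ , <-≤-trans (proj₂ (archimedean y)) h≤[1+h]² , ⟦ suc h ⟧ , refl
    where
    h = proj₁ (archimedean y)
    h≤[1+h]² : ⟦ h ⟧ ≤ ⟦ suc h ⟧ * ⟦ suc h ⟧
    h≤[1+h]² = ≤-by (0≤x+y 0≤1 (0≤x+y (0≤⟦n⟧ h) (0≤x² ⟦ h ⟧)))
      (solve 1 (λ h → (:1 :+ h) :* (:1 :+ h) :- h := :1 :+ (h :+ h :* h)) refl ⟦ h ⟧)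

  -- Squares are unbounded, so agreement there fixes all coefficients; this reaches every point,
  -- negative ones included, without taking square roots.
  square-roots : (M : Matrix n) (ev : Vector Carrier n) → HasRoots M ev → HasRoots (M · M) (λ i → ev i * ev i)
  square-roots M ev roots x = begin
    charPoly (M · M) x                           ≈⟨ eval-charPolynomial (M · M) x ⟨
    eval (charPolynomial (M · M)) x              ≈⟨ eval-cong (charPolynomial (M · M)) (fromRoots ev²) coeff-≈ x ⟩
    eval (fromRoots ev²) x                       ≈⟨ eval-fromRoots ev² x ⟩
    product (λ i → x - ev i * ev i)              ∎
    where
    ev² : Vector Carrier _
    ev² i = ev i * ev i
    coeff-≈ : ∀ k → coeff k (charPolynomial (M · M)) ≈ coeff k (fromRoots ev²)
    coeff-≈ = coeff-unique IsSquare squares-unbounded (charPolynomial (M · M)) (fromRoots ev²) 0# λ where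
      y _ (x , y≈x²) → begin
        eval (charPolynomial (M · M)) y            ≈⟨ eval-charPolynomial (M · M) y ⟩
        charPoly (M · M) y
          ≈⟨ det-cong {M = λ i j → y * identity i j - (M · M) i j} {N = λ i j → x * x * identity i j - (M · M) i j} (λ i j → +-congʳ (*-congʳ y≈x²)) ⟩
        charPoly (M · M) (x * x)                   ≈⟨ square-roots-at-squares M ev roots x ⟩
        product (λ i → x * x - ev² i)
          ≈⟨ product-cong {f = λ i → y - ev² i} {λ i → x * x - ev² i} (λ i → +-congʳ y≈x²) ⟨
        product (λ i → y - ev² i)                  ≈⟨ eval-fromRoots ev² y ⟨
        eval (fromRoots ev²) y                     ∎

  IsSymmetric : Matrix n → Set ℓ₁
  IsSymmetric M = ∀ i j → M i j ≈ M j i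

  -- The quadratic form of `M` at the all-ones vector.
  total : Matrix n → Carrier
  total M = sum λ i → sum (M i)

  square-symmetric : {M : Matrix n} → IsSymmetric M → IsSymmetric (M · M)
  square-symmetric M-sym i j = sum-cong λ k → trans (*-cong (M-sym i k) (M-sym k j)) (*-comm _ _)

  total-square : {M : Matrix n} → IsSymmetric M → total (M · M) ≈ sum λ k → sum (M k) * sum (M k)
  total-square {n} {M} M-sym = begin
    sum (λ i → sum λ j → sum λ k → M i k * M k j)
      ≈⟨ sum-cong (λ i → ∑-comm λ j k → M i k * M k j) ⟩
    sum (λ i → sum λ k → sum λ j → M i k * M k j)
      ≈⟨ sum-cong (λ i → sum-cong λ k → *-distribˡ-sum (M i k) (M k)) ⟨
    sum (λ i → sum λ k → M i k * sum (M k))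
      ≈⟨ ∑-comm (λ i k → M i k * sum (M k)) ⟩
    sum (λ k → sum λ i → M i k * sum (M k))
      ≈⟨ sum-cong (λ k → *-distribʳ-sum (sum (M k)) (λ i → M i k)) ⟨
    sum (λ k → sum (λ i → M i k) * sum (M k))
      ≈⟨ sum-cong (λ k → *-congʳ (sum-cong λ i → M-sym i k)) ⟩
    sum (λ k → sum (M k) * sum (M k)) ∎

  total²≤ : {M : Matrix n} → IsSymmetric M → total M * total M ≤ ⟦ n ⟧ * total (M · M)
  total²≤ {M = M} M-sym = ≤-respʳ (*-congˡ (sym (total-square M-sym))) (square-sum λ k → sum (M k))

  -- Cauchy-Schwarz in each row; for symmetric M the squares of all entries add up to the trace of
  -- M².
  total-square≤ : {M : Matrix n} → IsSymmetric M → total (M · M) ≤ ⟦ n ⟧ * trace (M · M)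
  total-square≤ {n} {M} M-sym = ≤-respˡ (sym (total-square M-sym)) (≤-respʳ (sym (*-distribˡ-sum ⟦ n ⟧ λ k → (M · M) k k))
    (sum-mono λ k → ≤-respʳ (*-congˡ (sum-cong λ j → *-congˡ (M-sym k j))) (square-sum (M k))))

  -- The power x^(2^q). Squaring the argument rather than the result lets the recursion follow M,
  -- M², M⁴, ....
  iteratedSquare : ℕ → Carrier → Carrier
  iteratedSquare zero    x = x
  iteratedSquare (suc q) x = iteratedSquare q (x * x)

  -- By Cauchy-Schwarz a lower bound r for the average row sum of M becomes r² for M². Only at the
  -- last square is the trace used, so the loss is a single factor n whatever q is.
  iteratedSquare-bound : ∀ q (M : Matrix (suc n)) ev {b r} → IsSymmetric M → HasRoots M ev → (∀ i → 0# ≤ ev i) →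
    (∀ i → ev i ≤ b) → 0# ≤ r → ⟦ suc n ⟧ * r ≤ total M →
    iteratedSquare q (r * r) ≤ ⟦ suc n ⟧ * iteratedSquare q (b * b)
  iteratedSquare-bound {n} q M ev {b} {r} M-sym roots 0≤ev ev≤b 0≤r nr≤total = go q
    where
    N = ⟦ suc n ⟧
    0<N : 0# < N
    0<N = 0<⟦1+n⟧ n
    nr²≤total : N * (r * r) ≤ total (M · M)
    nr²≤total = *-cancelˡ-≤ 0<N (≤-trans
      (≤-respˡ (solve 2 (λ n r → n :* r :* (n :* r) := n :* (n :* (r :* r)))
          refl N r) (x²≤y² (0≤x*y (<⇒≤ 0<N) 0≤r) nr≤total))
      (total²≤ M-sym))
    ev²≤b² : ∀ i → ev i * ev i ≤ b * b
    ev²≤b² i = x²≤y² (0≤ev i) (ev≤b i)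
    go : ∀ q → iteratedSquare q (r * r) ≤ N * iteratedSquare q (b * b)
    go zero    = *-cancelˡ-≤ 0<N (≤-trans nr²≤total (≤-trans (total-square≤ M-sym)
      (*-monoˡ-≤ (<⇒≤ 0<N) (≤-respˡ (sym (trace-roots (M · M) (λ i → ev i * ev i) (square-roots M ev roots)))
        (≤-respʳ (sum-const (suc n) (b * b)) (sum-mono ev²≤b²))))))
    go (suc q) = iteratedSquare-bound q (M · M) (λ i → ev i * ev i) (square-symmetric M-sym) (square-roots M ev roots)
      (λ i → 0≤x² (ev i)) ev²≤b² (0≤x² r) nr²≤total

  iteratedSquare-cong : ∀ q {x y} → x ≈ y → iteratedSquare q x ≈ iteratedSquare q y
  iteratedSquare-cong zero    x≈y = x≈y
  iteratedSquare-cong (suc q) x≈y = iteratedSquare-cong q (*-cong x≈y x≈y)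

  iteratedSquare-* : ∀ q x y → iteratedSquare q (x * y) ≈ iteratedSquare q x * iteratedSquare q y
  iteratedSquare-* zero    x y = refl
  iteratedSquare-* (suc q) x y = trans
    (iteratedSquare-cong q (solve 2 (λ x y → x :* y :* (x :* y) := x :* x :* (y :* y)) refl x y))
    (iteratedSquare-* q (x * x) (y * y))

  iteratedSquare-pos : ∀ q {x} → 0# < x → 0# < iteratedSquare q x
  iteratedSquare-pos zero    0<x = 0<x
  iteratedSquare-pos (suc q) 0<x = iteratedSquare-pos q (*-pos 0<x 0<x)

  -- Growth linear in q is enough, which keeps 2^q out of the statement. The induction hypothesis is
  -- applied to 2x + x², since (1 + x)² = 1 + (2x + x²).
  bernoulli : ∀ q {x} → 0# ≤ x → 1# + ⟦ suc q ⟧ * x ≤ iteratedSquare q (1# + x)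
  bernoulli zero    {x} 0≤x = ≤-reflexive (solve 1 (λ x → :1 :+ (:1 :+ :0) :* x := :1 :+ x) refl x)
  bernoulli (suc q) {x} 0≤x = ≤-trans
    (≤-by (0≤x+y (0≤x*y (0≤⟦n⟧ q) 0≤x) (0≤x*y (0≤⟦n⟧ (suc q)) (0≤x² x)))
      (solve 2 (λ q x → :1 :+ (:1 :+ q) :* (x :+ x :+ x :* x) :- (:1 :+ (:1 :+ (:1 :+ q)) :* x) := q :* x :+ (:1 :+ q) :* (x :* x))
          refl ⟦ q ⟧ x))
    (≤-respʳ (iteratedSquare-cong q (solve 1 (λ x → :1 :+ (x :+ x :+ x :* x) := (:1 :+ x) :* (:1 :+ x)) refl x))
      (bernoulli q (0≤x+y (0≤x+y 0≤x 0≤x) (0≤x² x))))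

  -- With r = b (1 + g), Bernoulli's inequality brings (1 + g)^(2^q) above k as soon as q exceeds
  -- k/g, and the Archimedean axiom provides such a q.
  iteratedSquare-dominates : ∀ {b r} → 0# < b → b < r → ∀ k → ∃[ q ] k * iteratedSquare q b < iteratedSquare q r
  iteratedSquare-dominates {b} {r} 0<b b<r k = q , <-respˡ (*-comm _ _) (<-respʳ (sym r^q) (<-by
      (*-pos (iteratedSquare-pos q 0<b) (x<y⇒0<y-x k<))
      (solve 3 (λ b t k → b :* t :- b :* k := b :* (t :- k)) refl (iteratedSquare q b) (iteratedSquare q (1# + g)) k)))
    where
    b⁻¹ = proj₁ (0<x⇒inverse 0<b)
    g = (r - b) * b⁻¹
    0<g : 0# < g
    0<g = *-pos (x<y⇒0<y-x b<r) (proj₁ (proj₂ (0<x⇒inverse 0<b)))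
    g⁻¹ = proj₁ (0<x⇒inverse 0<g)
    q = proj₁ (archimedean (k * g⁻¹))
    r≈ : r ≈ b * (1# + g)
    r≈ = begin
      r                                ≈⟨ solve 2 (λ r b → r := b :+ (r :- b) :* :1) refl r b ⟩
      b + (r - b) * 1#                 ≈⟨ +-congˡ (*-congˡ (proj₂ (proj₂ (0<x⇒inverse 0<b)))) ⟨
      b + (r - b) * (b * b⁻¹)
        ≈⟨ solve 3 (λ r b i → b :+ (r :- b) :* (b :* i) := b :* (:1 :+ (r :- b) :* i)) refl r b b⁻¹ ⟩
      b * (1# + g)                     ∎
    r^q : iteratedSquare q r ≈ iteratedSquare q b * iteratedSquare q (1# + g)
    r^q = trans (iteratedSquare-cong q r≈) (iteratedSquare-* q b (1# + g))
    k<qg : k < ⟦ q ⟧ * g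
    k<qg = <-by (*-pos 0<g (x<y⇒0<y-x (proj₂ (archimedean (k * g⁻¹))))) (begin
      ⟦ q ⟧ * g - k                    ≈⟨ solve 3 (λ q g k → q :* g :- k := q :* g :- k :* :1) refl ⟦ q ⟧ g k ⟩
      ⟦ q ⟧ * g - k * 1#               ≈⟨ +-congˡ (-‿cong (*-congˡ (proj₂ (proj₂ (0<x⇒inverse 0<g))))) ⟨
      ⟦ q ⟧ * g - k * (g * g⁻¹)
        ≈⟨ solve 4 (λ q g k i → q :* g :- k :* (g :* i) := g :* (q :- k :* i)) refl ⟦ q ⟧ g k g⁻¹ ⟩
      g * (⟦ q ⟧ - k * g⁻¹)            ∎)
    k< : k < iteratedSquare q (1# + g)
    k< = <-≤-trans k<qg (≤-trans
      (≤-by (0≤x+y 0≤1 (<⇒≤ 0<g)) (solve 2 (λ q g → :1 :+ (:1 :+ q) :* g :- q :* g := :1 :+ g) refl ⟦ q ⟧ g))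
      (bernoulli q (<⇒≤ 0<g)))

  -- The Rayleigh quotient at the all-ones vector, by the power method along the exponents 2^q.
  total≤n*largest : (M : Matrix (suc n)) (ev : Vector Carrier (suc n)) → IsSymmetric M →
    (∀ {i j} → i Fin.≤ j → ev j ≤ ev i) → HasRoots M ev → total M ≤ ⟦ suc n ⟧ * ev zero
  total≤n*largest {n} M ev M-sym ev-mono roots nev<total = contradiction (proj₂ dominates)
    (iteratedSquare-bound (proj₁ dominates) M+s (λ i → ev i + s) M+s-sym M+s-roots (λ i → <⇒≤ (0<ev+s i))
      (λ i → +-mono-≤ (ev-mono {zero} {i} z≤n) ≤-refl) (<⇒≤ (<.trans (0<ev+s zero) b<r)) (≤-reflexive Nr≈))
    where
    N = ⟦ suc n ⟧
    0<N = 0<⟦1+n⟧ n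
    N⁻¹ = proj₁ (0<x⇒inverse 0<N)
    NN⁻¹≈1 = proj₂ (proj₂ (0<x⇒inverse 0<N))
    -- The shift moves the smallest eigenvalue to 1: all eigenvalues become positive, so squaring
    -- keeps bounds on them and b is positive.
    s = 1# - ev (fromℕ n)
    b = ev zero + s
    r = total M * N⁻¹ + s
    M+s : Matrix (suc n)
    M+s i j = s * identity i j + M i j

    0<ev+s : ∀ i → 0# < ev i + s
    0<ev+s i = <-by (0<x+y 0<1 (x≤y⇒0≤y-x (ev-mono (≤fromℕ i))))
      (solve 2 (λ x y → x :+ (:1 :- y) :- :0 := :1 :+ (x :- y)) refl (ev i) (ev (fromℕ n)))

    b<r : b < r
    b<r = <-by (*-pos (x<y⇒0<y-x nev<total) (proj₁ (proj₂ (0<x⇒inverse 0<N)))) (begin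
      total M * N⁻¹ + s - (ev zero + s)
        ≈⟨ solve 4 (λ t i e s → t :* i :+ s :- (e :+ s) := t :* i :- e :* :1) refl (total M) N⁻¹ (ev zero) s ⟩
      total M * N⁻¹ - ev zero * 1#               ≈⟨ +-congˡ (-‿cong (*-congˡ NN⁻¹≈1)) ⟨
      total M * N⁻¹ - ev zero * (N * N⁻¹)
        ≈⟨ solve 4 (λ t i e n → t :* i :- e :* (n :* i) := (t :- n :* e) :* i) refl (total M) N⁻¹ (ev zero) N ⟩
      (total M - N * ev zero) * N⁻¹              ∎)

    M+s-sym : IsSymmetric M+s
    M+s-sym i j = +-cong (*-congˡ (identity-sym i j)) (M-sym i j)

    M+s-roots : HasRoots M+s (λ i → ev i + s)
    M+s-roots x = begin
      charPoly M+s x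
        ≈⟨ det-cong {M = λ i j → x * identity i j - M+s i j} {N = λ i j → (x - s) * identity i j - M i j} (λ i j →
             solve 4 (λ x d s m → x :* d :- (s :* d :+ m) := (x :- s) :* d :- m) refl x (identity i j) s (M i j)) ⟩
      charPoly M (x - s)                  ≈⟨ roots (x - s) ⟩
      product (λ i → x - s - ev i)
        ≈⟨ product-cong (λ i → solve 3 (λ x s e → x :- s :- e := x :- (e :+ s)) refl x s (ev i)) ⟩
      product (λ i → x - (ev i + s))      ∎

    row-sum : ∀ i → sum (M+s i) ≈ s + sum (M i)
    row-sum i = begin
      sum (λ j → s * identity i j + M i j)             ≈⟨ ∑-distrib-+ (λ j → s * identity i j) (M i) ⟩
      sum (λ j → s * identity i j) + sum (M i)         ≈⟨ +-congʳ (sum-cong λ j → *-comm s (identity i j)) ⟩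
      sum (λ j → identity i j * s) + sum (M i)         ≈⟨ +-congʳ (sum-identity i λ _ → s) ⟩
      s + sum (M i)                                    ∎

    Nr≈ : N * r ≈ total M+s
    Nr≈ = begin
      N * (total M * N⁻¹ + s)
        ≈⟨ solve 4 (λ n t i s → n :* (t :* i :+ s) := n :* s :+ t :* (n :* i)) refl N (total M) N⁻¹ s ⟩
      N * s + total M * (N * N⁻¹)                      ≈⟨ +-congˡ (trans (*-congˡ NN⁻¹≈1) (*-identityʳ _)) ⟩
      N * s + total M                                  ≈⟨ +-congʳ (sum-const (suc n) s) ⟨
      sum {suc n} (λ _ → s) + total M                  ≈⟨ ∑-distrib-+ {suc n} (λ _ → s) (λ i → sum (M i)) ⟨
      sum (λ i → s + sum (M i))                        ≈⟨ sum-cong row-sum ⟨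
      total M+s                                        ∎

    b²<r² : b * b < r * r
    b²<r² = <-by (*-pos (x<y⇒0<y-x b<r) (0<x+y (0<ev+s zero) (<⇒≤ (<.trans (0<ev+s zero) b<r))))
      (solve 2 (λ b r → r :* r :- b :* b := (r :- b) :* (b :+ r)) refl b r)

    dominates = iteratedSquare-dominates (*-pos (0<ev+s zero) (0<ev+s zero)) b²<r² N

  -- Graphs

  sum-≤-initial : (l≤m : l ℕ.≤ m) (v : Vector Carrier m) → ∀ x → (∀ i → v i ≤ x) →
    sum v ≤ S l≤m v + (⟦ m ⟧ - ⟦ l ⟧) * x
  sum-≤-initial {m = m} z≤n v x v≤x = ≤-respʳ
    (trans (sum-const m x) (solve 2 (λ m x → m :* x := :0 :+ (m :- :0) :* x) refl ⟦ m ⟧ x)) (sum-mono v≤x)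
  sum-≤-initial {suc l} {suc m} (s≤s l≤m) v x v≤x = ≤-respʳ
    (solve 5 (λ v s m l x → v :+ (s :+ (m :- l) :* x) := v :+ s :+ (:1 :+ m :- (:1 :+ l)) :* x) refl
       (v zero) (S l≤m (v ∘ suc)) ⟦ m ⟧ ⟦ l ⟧ x)
    (+-mono-≤ ≤-refl (sum-≤-initial l≤m (v ∘ suc) x (v≤x ∘ suc)))

  -- Prepending v to a list with sum t whose first l terms add up to s raises m s - l t by s + (m -
  -- l) v - t, which is nonnegative because the m - l omitted terms are at most v.
  average≤initial-average : (l≤m : l ℕ.≤ m) (v : Vector Carrier m) → (∀ {i j} → i Fin.≤ j → v j ≤ v i) →
    ⟦ l ⟧ * sum v ≤ ⟦ m ⟧ * S l≤m v
  average≤initial-average z≤n v v-mono = ≤-reflexive (trans (zeroˡ _) (sym (zeroʳ _)))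
  average≤initial-average {suc l} {suc m} (s≤s l≤m) v v-mono = ≤-by
    (0≤x+y (x≤y⇒0≤y-x (average≤initial-average l≤m (v ∘ suc) (λ i≤j → v-mono (s≤s i≤j))))
           (x≤y⇒0≤y-x (sum-≤-initial l≤m (v ∘ suc) (v zero) (λ i → v-mono {zero} {suc i} z≤n))))
    (solve 5 (λ l m v s t → (:1 :+ m) :* (v :+ s) :- (:1 :+ l) :* (v :+ t) := (m :* s :- l :* t) :+ (s :+ (m :- l) :* v :- t)) refl
       ⟦ l ⟧ ⟦ m ⟧ (v zero) (S l≤m (v ∘ suc)) (sum (v ∘ suc)))

  -- For n = m + 1 and k = l + 1: the largest eigenvalue is kept, and the next l are replaced by l
  -- times the average of all the others.
  S-lower : (l≤m : l ℕ.≤ m) (ev : Vector Carrier (suc m)) → (∀ {i j} → i Fin.≤ j → ev j ≤ ev i) →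
    (⟦ m ⟧ - ⟦ l ⟧) * ev zero + ⟦ l ⟧ * sum ev ≤ ⟦ m ⟧ * S (s≤s l≤m) ev
  S-lower {l} {m} l≤m ev ev-mono = ≤-by
    (x≤y⇒0≤y-x (average≤initial-average l≤m (ev ∘ suc) (λ i≤j → ev-mono (s≤s i≤j))))
    (solve 5 (λ l m v s t → m :* (v :+ s) :- ((m :- l) :* v :+ l :* (v :+ t)) := m :* s :- l :* t) refl
       ⟦ l ⟧ ⟦ m ⟧ (ev zero) (S l≤m (ev ∘ suc)) (sum (ev ∘ suc)))

  S-sum-lower : (l≤m : l ℕ.≤ m) (ev ev′ : Vector Carrier (suc m)) →
    (∀ {i j} → i Fin.≤ j → ev j ≤ ev i) → (∀ {i j} → i Fin.≤ j → ev′ j ≤ ev′ i) → ∀ x →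
    ⟦ m ⟧ ≤ ev zero + ev′ zero → sum ev + sum ev′ ≈ x * ⟦ m ⟧ →
    (⟦ m ⟧ - ⟦ l ⟧) + ⟦ l ⟧ * x ≤ S (s≤s l≤m) ev + S (s≤s l≤m) ev′
  -- A single vertex: there is no positive factor m to cancel, and the claim is the hypothesis on
  -- the largest eigenvalues.
  S-sum-lower {m = zero} z≤n ev ev′ ev-mono ev′-mono x m≤ sums = ≤-by m≤
    (solve 3 (λ e e′ x → (e :+ :0) :+ (e′ :+ :0) :- ((:0 :- :0) :+ :0 :* x) := e :+ e′) refl (ev zero) (ev′ zero) x)
  S-sum-lower {l} {suc m} l≤m ev ev′ ev-mono ev′-mono x m≤ sums = *-cancelˡ-≤ (0<⟦1+n⟧ m) (≤-trans
    (≤-by (0≤x*y (x≤y⇒0≤y-x (⟦⟧-mono l≤m)) (x≤y⇒0≤y-x m≤)) (begin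
      ((M - L) * ev zero + L * sum ev) + ((M - L) * ev′ zero + L * sum ev′) - M * ((M - L) + L * x)
        ≈⟨ solve 7 (λ M L e s e′ s′ x →
             ((M :- L) :* e :+ L :* s) :+ ((M :- L) :* e′ :+ L :* s′) :- M :* ((M :- L) :+ L :* x)
               := (M :- L) :* (e :+ e′ :- M) :+ L :* (s :+ s′ :- x :* M))
                   refl M L (ev zero) (sum ev) (ev′ zero) (sum ev′) x ⟩
      (M - L) * (ev zero + ev′ zero - M) + L * (sum ev + sum ev′ - x * M)
        ≈⟨ +-congˡ (*-congˡ (trans (+-congʳ sums) (-‿inverseʳ _))) ⟩
      (M - L) * (ev zero + ev′ zero - M) + L * 0#
        ≈⟨ trans (+-congˡ (zeroʳ L)) (+-identityʳ _) ⟩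
      (M - L) * (ev zero + ev′ zero - M) ∎))
    (≤-respʳ (sym (distribˡ M (S (s≤s l≤m) ev) (S (s≤s l≤m) ev′))) (+-mono-≤ (S-lower l≤m ev ev-mono) (S-lower l≤m ev′ ev′-mono))))
    where
    M = ⟦ suc m ⟧
    L = ⟦ l ⟧

  indicator : Bool → Carrier
  indicator b = if b then 1# else 0#

  ⟦∣tabulate∣⟧ : (f : Fin n → Bool) → ⟦ ∣ tabulate f ∣ ⟧ ≈ sum (λ i → indicator (f i))
  ⟦∣tabulate∣⟧ {zero}  f = refl
  ⟦∣tabulate∣⟧ {suc n} f with f zero
  ... | true  = +-congˡ (⟦∣tabulate∣⟧ (f ∘ suc))
  ... | false = trans (⟦∣tabulate∣⟧ (f ∘ suc)) (sym (+-identityˡ _))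

  ⟦∣∣⟧ : (S : Subset n) → ⟦ ∣ S ∣ ⟧ ≈ sum (λ i → indicator (lookup S i))
  ⟦∣∣⟧ []          = refl
  ⟦∣∣⟧ (true ∷ S)  = +-congˡ (⟦∣∣⟧ S)
  ⟦∣∣⟧ (false ∷ S) = trans (⟦∣∣⟧ S) (sym (+-identityˡ _))

  restrict-indicator : (S : Subset n) (v : Vector Carrier n) → ∀ j → restrict S v j ≈ indicator (lookup S j) * v j
  restrict-indicator S v j = go (lookup S j)
    where
    go : ∀ b → (if b then v j else 0#) ≈ indicator b * v j
    go true  = sym (*-identityˡ _)
    go false = sym (zeroˡ _)

  indicator-nonneg : ∀ b → 0# ≤ indicator b
  indicator-nonneg true  = 0≤1
  indicator-nonneg false = ≤-refl

  sum-identityˡ : (i : Fin n) → sum (identity i) ≈ 1#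
  sum-identityˡ i = trans (sum-cong λ j → sym (*-identityʳ (identity i j))) (sum-identity i λ _ → 1#)

  -- Degrees, row sums and eigenvalue bounds of one graph

  module _ {n} (G : Graph n) where

    deg : Fin n → Carrier
    deg i = ⟦ degree G i ⟧

    deg≈sum : ∀ i → deg i ≈ sum (A G i)
    deg≈sum i = ⟦∣tabulate∣⟧ (adj G i)

    D≈ : ∀ i j → D G i j ≈ identity i j * deg i
    D≈ i j with i ≟ j
    ... | yes _ = sym (*-identityˡ _)
    ... | no  _ = sym (zeroˡ _)

    A-irrefl : ∀ i → A G i i ≈ 0#
    A-irrefl i = reflexive (≡.cong indicator (adj-irrefl G i))

    A+identity≤1 : ∀ i j → A G i j + identity i j ≤ 1#
    A+identity≤1 i j with i ≟ j
    ... | yes ≡.refl = ≤-reflexive (trans (+-congʳ (A-irrefl i)) (+-identityˡ 1#))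
    ... | no  _      = ≤-respˡ (sym (+-identityʳ _)) (indicator≤1 (adj G i j))
      where
      indicator≤1 : ∀ b → indicator b ≤ 1#
      indicator≤1 true  = ≤-refl
      indicator≤1 false = 0≤1

    A+A′+identity : ∀ i j → A G i j + A (complement G) i j + identity i j ≈ 1#
    A+A′+identity i j with i ≟ j
    ... | yes ≡.refl = lem (adj G i i) (adj-irrefl G i)
      where
      lem : ∀ b → b ≡ false → indicator b + indicator (not b ∧ false) + 1# ≈ 1#
      lem false _ = solve 0 (:0 :+ :0 :+ :1 := :1) refl
    ... | no  _      = lem (adj G i j)
      where
      lem : ∀ b → indicator b + indicator (not b ∧ true) + 0# ≈ 1#
      lem true  = solve 0 (:1 :+ :0 :+ :0 := :1) refl
      lem false = solve 0 (:0 :+ :1 :+ :0 := :1) refl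

    module _ (α : Carrier) where

      A[α]-entry : ∀ i j → A[ α ] G i j ≈ identity i j * (α * deg i) + (1# - α) * A G i j
      A[α]-entry i j = +-congʳ (trans (*-congˡ (D≈ i j)) (solve 3 (λ a e d → a :* (e :* d) := e :* (a :* d))
          refl α (identity i j) (deg i)))

      A[α]-symmetric : IsSymmetric (A[ α ] G)
      A[α]-symmetric i j = +-cong (*-congˡ D-sym) (*-congˡ (reflexive (≡.cong indicator (adj-sym G i j))))
        where
        D-sym : D G i j ≈ D G j i
        D-sym with i ≟ j | j ≟ i
        ... | yes ≡.refl | yes _  = refl
        ... | yes i≡j    | no j≢i = contradiction (≡.sym i≡j) j≢i
        ... | no i≢j     | yes j≡i = contradiction (≡.sym j≡i) i≢j
        ... | no _       | no _   = refl

      A[α]-row-sum : ∀ i → sum (A[ α ] G i) ≈ deg i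
      A[α]-row-sum i = begin
        sum (A[ α ] G i)                                                           ≈⟨ sum-cong (A[α]-entry i) ⟩
        sum (λ j → identity i j * (α * deg i) + (1# - α) * A G i j)
          ≈⟨ ∑-distrib-+ (λ j → identity i j * (α * deg i)) (λ j → (1# - α) * A G i j) ⟩
        sum (λ j → identity i j * (α * deg i)) + sum (λ j → (1# - α) * A G i j)
          ≈⟨ +-cong (sum-identity i λ _ → α * deg i) (sym (*-distribˡ-sum (1# - α) (A G i))) ⟩
        α * deg i + (1# - α) * sum (A G i)                                  ≈⟨ +-congˡ (*-congˡ (deg≈sum i)) ⟨
        α * deg i + (1# - α) * deg i
          ≈⟨ solve 2 (λ a d → a :* d :+ (:1 :- a) :* d := d) refl α (deg i) ⟩
        deg i                                                               ∎

      A[α]-diagonal : ∀ i → A[ α ] G i i ≈ α * deg i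
      A[α]-diagonal i = begin
        A[ α ] G i i                                                 ≈⟨ A[α]-entry i i ⟩
        identity i i * (α * deg i) + (1# - α) * A G i i
          ≈⟨ +-cong (*-congʳ (identity-diagonal i)) (*-congˡ (A-irrefl i)) ⟩
        1# * (α * deg i) + (1# - α) * 0#
          ≈⟨ solve 2 (λ x a → :1 :* x :+ (:1 :- a) :* :0 := x) refl (α * deg i) α ⟩
        α * deg i                                             ∎

      module _ (0≤α : 0# ≤ α) (α≤1 : α ≤ 1#) (b : Carrier) (deg≤b : ∀ i → deg i ≤ b) where

        threshold : ℕ → Carrier
        threshold j = α * b + (1# - α) * (⟦ n ⟧ - 1# - ⟦ j ⟧)

        A[α]-eigenvalue≤ : (ev : Vector Carrier n) → IsSpectrum (A[ α ] G) ev → ∀ j → ev j ≤ threshold (toℕ j)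
        A[α]-eigenvalue≤ ev spec j = eigenvalue≤-by-minors t (A[ α ] G) ev non-increasing roots j isM
          where
          open IsSpectrum spec
          t = threshold (toℕ j)
          T : Matrix n
          T i k = t * identity i k - A[ α ] G i k

          isM : ∀ S → ∣ S ∣ ℕ.+ toℕ j ℕ.≤ n → IsRestrictedMMatrix S (select S identity T)
          isM S S+j≤n = record
            { outside      = λ i i∉S k → reflexive (≡.cong (λ v → v k) (select-outside S identity T i i∉S))
            ; off-diagonal = λ i k i∈S i≢k → ≤-respˡ (reflexive (≡.sym (≡.cong (λ v → v k) (select-inside S identity T i i∈S)))) (T≤0 i≢k)
            ; row-sum      = λ i i∈S → ≤-respʳ (sum-cong λ k → reflexive (≡.sym (≡.cong (λ v → restrict S v k) (select-inside S identity T i i∈S)))) (0≤row i i∈S)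
            }
            where
            T≤0 : ∀ {i k} → i ≢ k → T i k ≤ 0#
            T≤0 {i} {k} i≢k = ≤-by (0≤x*y (x≤y⇒0≤y-x α≤1) (indicator-nonneg (adj G i k))) (begin
              0# - (t * identity i k - A[ α ] G i k)
                ≈⟨ +-congˡ (-‿cong (+-cong (*-congˡ (identity-off-diagonal i≢k)) (-‿cong (trans (A[α]-entry i k) (+-congʳ (*-congʳ (identity-off-diagonal i≢k))))))) ⟩
              0# - (t * 0# - (0# * (α * deg i) + (1# - α) * A G i k))
                ≈⟨ solve 3 (λ t d m → :0 :- (t :* :0 :- (:0 :* d :+ m)) := m) refl t (α * deg i) ((1# - α) * A G i k) ⟩
              (1# - α) * A G i k ∎)

            w : Fin n → Carrier
            w k = indicator (lookup S k)

            -- The entries row i would have if vertex i were adjacent to all other vertices. This is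
            -- the worst case, and its sum depends on `S` only through the size of `S`.
            lower : ∀ i → Fin n → Carrier
            lower i k = identity i k * (w k * (t - α * deg i + (1# - α))) + (1# - α) * - w k

            lower≤ : ∀ i k → lower i k ≤ restrict S (T i) k
            lower≤ i k = ≤-by
              (0≤x*y (x≤y⇒0≤y-x α≤1) (0≤x*y (indicator-nonneg (lookup S k)) (x≤y⇒0≤y-x (A+identity≤1 i k))))
              (begin
                restrict S (T i) k - lower i k
                  ≈⟨ +-congʳ (trans (restrict-indicator S (T i) k) (*-congˡ (+-congˡ (-‿cong (A[α]-entry i k))))) ⟩
                w k * (t * identity i k - (identity i k * (α * deg i) + (1# - α) * A G i k)) - lower i k
                  ≈⟨ solve 6 (λ w t e d a x →
                       w :* (t :* e :- (e :* d :+ a :* x)) :- (e :* (w :* (t :- d :+ a)) :+ a :* (:- w)) := a :* (w :* (:1 :- (x :+ e)))) refl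
                       (w k) t (identity i k) (α * deg i) (1# - α) (A G i k) ⟩
                (1# - α) * (w k * (1# - (A G i k + identity i k))) ∎)

            sum-lower : ∀ i → lookup S i ≡ true → sum (lower i) ≈ t - α * deg i + (1# - α) + (1# - α) * - ⟦ ∣ S ∣ ⟧
            sum-lower i i∈S = begin
              sum (lower i)
                ≈⟨ ∑-distrib-+ (λ k → identity i k * (w k * (t - α * deg i + (1# - α)))) (λ k → (1# - α) * - w k) ⟩
              sum (λ k → identity i k * (w k * (t - α * deg i + (1# - α)))) + sum (λ k → (1# - α) * - w k)
                ≈⟨ +-cong (sum-identity i (λ k → w k * (t - α * deg i + (1# - α))))
                     (trans (sym (*-distribˡ-sum (1# - α) (λ k → - w k))) (*-congˡ (trans (sum-neg w) (-‿cong (sym (⟦∣∣⟧ S)))))) ⟩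
              w i * (t - α * deg i + (1# - α)) + (1# - α) * - ⟦ ∣ S ∣ ⟧
                ≈⟨ +-congʳ (trans (*-congʳ (reflexive (≡.cong indicator i∈S))) (*-identityˡ _)) ⟩
              t - α * deg i + (1# - α) + (1# - α) * - ⟦ ∣ S ∣ ⟧ ∎

            0≤row : ∀ i → lookup S i ≡ true → 0# ≤ sum (restrict S (T i))
            0≤row i i∈S = ≤-trans (≤-respʳ (sym (sum-lower i i∈S)) (≤-by
              -- The threshold is chosen to leave exactly the slack α(b - deg i) + (1 - α)(n - |S| -
              -- j).
              (0≤x+y (0≤x*y 0≤α (x≤y⇒0≤y-x (deg≤b i)))
                     (0≤x*y (x≤y⇒0≤y-x α≤1) (x≤y⇒0≤y-x (≤-respˡ (⟦⟧-+ ∣ S ∣ (toℕ j)) (⟦⟧-mono S+j≤n)))))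
              (solve 6 (λ α b n j d s →
                 (α :* b :+ (:1 :- α) :* (n :- :1 :- j)) :- α :* d :+ (:1 :- α) :+ (:1 :- α) :* (:- s) :- :0
                   := α :* (b :- d) :+ (:1 :- α) :* (n :- (s :+ j))) refl
                 α b ⟦ n ⟧ ⟦ toℕ j ⟧ (deg i) ⟦ ∣ S ∣ ⟧)))
              (sum-mono (lower≤ i))

        S≤ : (ev : Vector Carrier n) → IsSpectrum (A[ α ] G) ev → (k≤n : k ℕ.≤ n) →
          S k≤n ev ≤ ⟦ k ⟧ * (α * b + (1# - α) * (⟦ n ⟧ - 1#)) - (1# - α) * sum {k} (λ i → ⟦ toℕ i ⟧)
        S≤ {k} ev spec k≤n = ≤-trans
          (sum-mono λ i → ≤-respʳ (reflexive (≡.cong threshold (toℕ-inject≤ i k≤n))) (A[α]-eigenvalue≤ ev spec (inject≤ i k≤n)))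
          (≤-reflexive (begin
            sum {k} (λ i → threshold (toℕ i))
              ≈⟨ sum-cong {k} (λ i → solve 4 (λ x a n j → x :+ a :* (n :- :1 :- j) := (x :+ a :* (n :- :1)) :+ (:- a) :* j)
                  refl (α * b) (1# - α) ⟦ n ⟧ ⟦ toℕ i ⟧) ⟩
            sum {k} (λ i → (α * b + (1# - α) * (⟦ n ⟧ - 1#)) + - (1# - α) * ⟦ toℕ i ⟧)
              ≈⟨ ∑-distrib-+ {k} (λ i → α * b + (1# - α) * (⟦ n ⟧ - 1#)) (λ i → - (1# - α) * ⟦ toℕ i ⟧) ⟩
            sum {k} (λ i → α * b + (1# - α) * (⟦ n ⟧ - 1#)) + sum {k} (λ i → - (1# - α) * ⟦ toℕ i ⟧)
              ≈⟨ +-cong (sum-const k _) (sym (*-distribˡ-sum {k} (- (1# - α)) (λ i → ⟦ toℕ i ⟧))) ⟩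
            ⟦ k ⟧ * (α * b + (1# - α) * (⟦ n ⟧ - 1#)) + - (1# - α) * sum {k} (λ i → ⟦ toℕ i ⟧)
              ≈⟨ solve 3 (λ x a s → x :+ (:- a) :* s := x :- a :* s) refl _ (1# - α) (sum {k} (λ i → ⟦ toℕ i ⟧)) ⟩
            ⟦ k ⟧ * (α * b + (1# - α) * (⟦ n ⟧ - 1#)) - (1# - α) * sum {k} (λ i → ⟦ toℕ i ⟧) ∎))

  -- A graph together with its complement

  deg+deg′ : (G : Graph n) → ∀ i → deg G i + deg (complement G) i + 1# ≈ ⟦ n ⟧
  deg+deg′ {n} G i = begin
    deg G i + deg G′ i + 1#
      ≈⟨ +-cong (+-cong (deg≈sum G i) (deg≈sum G′ i)) (sym (sum-identityˡ i)) ⟩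
    sum (A G i) + sum (A G′ i) + sum (identity i)
      ≈⟨ +-congʳ (∑-distrib-+ (A G i) (A G′ i)) ⟨
    sum (λ j → A G i j + A G′ i j) + sum (identity i)
      ≈⟨ ∑-distrib-+ (λ j → A G i j + A G′ i j) (identity i) ⟨
    sum (λ j → A G i j + A G′ i j + identity i j)
      ≈⟨ sum-cong (A+A′+identity G i) ⟩
    sum {n} (λ _ → 1#)
      ≈⟨ trans (sum-const n 1#) (*-identityʳ _) ⟩
    ⟦ n ⟧ ∎
    where G′ = complement G

  -- Doubling avoids a division by 2, and the double is what occurs: the graph and its complement
  -- contribute one copy each.
  sum-toℕ : ∀ k → sum {k} (λ i → ⟦ toℕ i ⟧) + sum {k} (λ i → ⟦ toℕ i ⟧) ≈ ⟦ k ⟧ * (⟦ k ⟧ - 1#)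
  sum-toℕ zero    = trans (+-identityˡ 0#) (sym (zeroˡ _))
  sum-toℕ (suc k) = begin
    (0# + s⁺) + (0# + s⁺)             ≈⟨ +-cong (+-congˡ s⁺≈) (+-congˡ s⁺≈) ⟩
    (0# + (⟦ k ⟧ * 1# + s)) + (0# + (⟦ k ⟧ * 1# + s))
      ≈⟨ solve 2 (λ k s → (:0 :+ (k :* :1 :+ s)) :+ (:0 :+ (k :* :1 :+ s)) := k :+ k :+ (s :+ s)) refl ⟦ k ⟧ s ⟩
    ⟦ k ⟧ + ⟦ k ⟧ + (s + s)           ≈⟨ +-congˡ (sum-toℕ k) ⟩
    ⟦ k ⟧ + ⟦ k ⟧ + ⟦ k ⟧ * (⟦ k ⟧ - 1#)
      ≈⟨ solve 1 (λ k → k :+ k :+ k :* (k :- :1) := (:1 :+ k) :* ((:1 :+ k) :- :1)) refl ⟦ k ⟧ ⟩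
    ⟦ suc k ⟧ * (⟦ suc k ⟧ - 1#)      ∎
    where
    s = sum {k} (λ i → ⟦ toℕ i ⟧)
    s⁺ = sum {k} (λ i → 1# + ⟦ toℕ i ⟧)
    s⁺≈ : s⁺ ≈ ⟦ k ⟧ * 1# + s
    s⁺≈ = trans (∑-distrib-+ {k} (λ _ → 1#) (λ i → ⟦ toℕ i ⟧)) (+-congʳ (sum-const k 1#))

  module _ (G : Graph n) (α : Carrier) (ev ev′ : Vector Carrier n)
    (spec : IsSpectrum (A[ α ] G) ev) (spec′ : IsSpectrum (A[ α ] (complement G)) ev′) where

    private
      G′ = complement G

    upper : ∀ {Δ δ} → (∀ i → degree G i ℕ.≤ Δ) → (∀ i → δ ℕ.≤ degree G i) → 0# ≤ α → α ≤ 1# → (k≤n : k ℕ.≤ n) →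
      S k≤n ev + S k≤n ev′ ≤
        ⟦ k ⟧ * ((⟦ 2 ⟧ - α) * ⟦ n ⟧ + α * (⟦ Δ ⟧ - ⟦ δ ⟧ - 1#) - (1# - α) * (⟦ k ⟧ + 1#))
    upper {k} {Δ} {δ} deg≤Δ δ≤deg 0≤α α≤1 k≤n = ≤-trans
      (+-mono-≤ (S≤ G α 0≤α α≤1 ⟦ Δ ⟧ (λ i → ⟦⟧-mono (deg≤Δ i)) ev spec k≤n)
                (S≤ G′ α 0≤α α≤1 (⟦ n ⟧ - 1# - ⟦ δ ⟧) deg′≤ ev′ spec′ k≤n))
      (≤-reflexive (begin
        (K * (α * ⟦ Δ ⟧ + (1# - α) * (N - 1#)) - (1# - α) * s) + (K * (α * (N - 1# - ⟦ δ ⟧) + (1# - α) * (N - 1#)) - (1# - α) * s)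
          ≈⟨ solve 6 (λ K α Δ δ N s →
               (K :* (α :* Δ :+ (:1 :- α) :* (N :- :1)) :- (:1 :- α) :* s) :+ (K :* (α :* (N :- :1 :- δ) :+ (:1 :- α) :* (N :- :1)) :- (:1 :- α) :* s)
                 := K :* (α :* (Δ :+ (N :- :1 :- δ)) :+ (:1 :- α) :* (N :- :1 :+ (N :- :1))) :- (:1 :- α) :* (s :+ s))
                     refl K α ⟦ Δ ⟧ ⟦ δ ⟧ N s ⟩
        K * (α * (⟦ Δ ⟧ + (N - 1# - ⟦ δ ⟧)) + (1# - α) * (N - 1# + (N - 1#))) - (1# - α) * (s + s)
          ≈⟨ +-congˡ (-‿cong (*-congˡ (sum-toℕ k))) ⟩
        K * (α * (⟦ Δ ⟧ + (N - 1# - ⟦ δ ⟧)) + (1# - α) * (N - 1# + (N - 1#))) - (1# - α) * (K * (K - 1#))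
          ≈⟨ solve 5 (λ K α Δ δ N →
               K :* (α :* (Δ :+ (N :- :1 :- δ)) :+ (:1 :- α) :* (N :- :1 :+ (N :- :1))) :- (:1 :- α) :* (K :* (K :- :1))
                 := K :* ((:1 :+ (:1 :+ :0) :- α) :* N :+ α :* (Δ :- δ :- :1) :- (:1 :- α) :* (K :+ :1)))
                     refl K α ⟦ Δ ⟧ ⟦ δ ⟧ N ⟩
        K * ((⟦ 2 ⟧ - α) * N + α * (⟦ Δ ⟧ - ⟦ δ ⟧ - 1#) - (1# - α) * (K + 1#)) ∎))
      where
      K = ⟦ k ⟧
      N = ⟦ n ⟧
      s = sum {k} (λ i → ⟦ toℕ i ⟧)
      deg′≤ : ∀ i → deg G′ i ≤ N - 1# - ⟦ δ ⟧
      deg′≤ i = ≤-by (x≤y⇒0≤y-x (⟦⟧-mono (δ≤deg i))) (begin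
        N - 1# - ⟦ δ ⟧ - deg G′ i                                   ≈⟨ +-congʳ (+-congʳ (+-congʳ (deg+deg′ G i))) ⟨
        deg G i + deg G′ i + 1# - 1# - ⟦ δ ⟧ - deg G′ i
          ≈⟨ solve 3 (λ d e δ → d :+ e :+ :1 :- :1 :- δ :- e := d :- δ) refl (deg G i) (deg G′ i) ⟦ δ ⟧ ⟩
        deg G i - ⟦ δ ⟧                                             ∎)

  module _ (G : Graph (suc m)) (α : Carrier) (ev ev′ : Vector Carrier (suc m))
    (spec : IsSpectrum (A[ α ] G) ev) (spec′ : IsSpectrum (A[ α ] (complement G)) ev′) where

    private
      G′ = complement G
      N = ⟦ suc m ⟧

    sum-degrees : sum (deg G) + sum (deg G′) ≈ N * ⟦ m ⟧
    sum-degrees = begin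
      sum (deg G) + sum (deg G′)            ≈⟨ ∑-distrib-+ (deg G) (deg G′) ⟨
      sum (λ i → deg G i + deg G′ i)
        ≈⟨ sum-cong (λ i → trans (solve 1 (λ d → d := d :+ :1 :- :1)
            refl (deg G i + deg G′ i)) (+-congʳ (deg+deg′ G i))) ⟩
      sum {suc m} (λ i → N - 1#)            ≈⟨ sum-const (suc m) (N - 1#) ⟩
      N * (N - 1#)                          ≈⟨ *-congˡ (solve 1 (λ m → :1 :+ m :- :1 := m) refl ⟦ m ⟧) ⟩
      N * ⟦ m ⟧                             ∎

    largest : ⟦ m ⟧ ≤ ev zero + ev′ zero
    largest = *-cancelˡ-≤ (0<⟦1+n⟧ m) (≤-respˡ
      (trans (+-cong (sum-cong (A[α]-row-sum G α)) (sum-cong (A[α]-row-sum G′ α))) sum-degrees)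
      (≤-respʳ (sym (distribˡ N (ev zero) (ev′ zero)))
        (+-mono-≤ (total≤n*largest (A[ α ] G) ev (A[α]-symmetric G α) (IsSpectrum.non-increasing spec) (IsSpectrum.roots spec))
                  (total≤n*largest (A[ α ] G′) ev′ (A[α]-symmetric G′ α) (IsSpectrum.non-increasing spec′) (IsSpectrum.roots spec′)))))

    sum-eigenvalues : sum ev + sum ev′ ≈ α * (N * ⟦ m ⟧)
    sum-eigenvalues = begin
      sum ev + sum ev′
        ≈⟨ +-cong (trace-roots (A[ α ] G) ev (IsSpectrum.roots spec)) (trace-roots (A[ α ] G′) ev′ (IsSpectrum.roots spec′)) ⟨
      trace (A[ α ] G) + trace (A[ α ] G′)
        ≈⟨ +-cong (trans (sum-cong (A[α]-diagonal G α)) (sym (*-distribˡ-sum α (deg G)))) (trans (sum-cong (A[α]-diagonal G′ α)) (sym (*-distribˡ-sum α (deg G′)))) ⟩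
      α * sum (deg G) + α * sum (deg G′)    ≈⟨ distribˡ α _ _ ⟨
      α * (sum (deg G) + sum (deg G′))      ≈⟨ *-congˡ sum-degrees ⟩
      α * (N * ⟦ m ⟧)                       ∎

    lower : (l≤m : l ℕ.≤ m) → (1# - α) * N + (α * N - 1#) * ⟦ suc l ⟧ ≤ S (s≤s l≤m) ev + S (s≤s l≤m) ev′
    lower {l} l≤m = ≤-respˡ
      -- With n = m + 1 and k = l + 1 this regroups (n - k) + (k - 1)αn.
      (solve 3 (λ α m l → (m :- l) :+ l :* (α :* (:1 :+ m)) := (:1 :- α) :* (:1 :+ m) :+ (α :* (:1 :+ m) :- :1) :* (:1 :+ l))
          refl α ⟦ m ⟧ ⟦ l ⟧)
      (S-sum-lower l≤m ev ev′ (IsSpectrum.non-increasing spec) (IsSpectrum.non-increasing spec′) (α * N) largest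
        (trans sum-eigenvalues (sym (*-assoc α N ⟦ m ⟧))))

theorem6p1 : ∀ {c ℓ₁ ℓ₂} (ℝ : RealNumbers c ℓ₁ ℓ₂) →
    let open RealNumbers ℝ
        open Spectral ℝ
    in
    (n : ℕ) (G : Graph n) (Δ δ : ℕ) →
    IsMaxDegree G Δ → IsMinDegree G δ →
    (α : Carrier) → 0# ≤ α → α ≤ 1# →
    (k : ℕ) → 1 ℕ.≤ k → (k≤n : k ℕ.≤ n) →
    (ev ev′ : Vector Carrier n) →
    IsSpectrum (A[ α ] G) ev →
    IsSpectrum (A[ α ] (complement G)) ev′ →
    ((1# - α) * ⟦ n ⟧ + (α * ⟦ n ⟧ - 1#) * ⟦ k ⟧ ≤ S k≤n ev + S k≤n ev′)
    ×
    (S k≤n ev + S k≤n ev′ ≤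
      ⟦ k ⟧ * ((⟦ 2 ⟧ - α) * ⟦ n ⟧ + α * (⟦ Δ ⟧ - ⟦ δ ⟧ - 1#) - (1# - α) * (⟦ k ⟧ + 1#)))
theorem6p1 ℝ (suc _) G _ _ (_ , deg≤Δ) (_ , δ≤deg) α 0≤α α≤1 (suc _) _ k≤n@(s≤s l≤m) ev ev′ spec spec′ =
  lower G α ev ev′ spec spec′ l≤m , upper G α ev ev′ spec spec′ deg≤Δ δ≤deg 0≤α α≤1 k≤n
  where open SpectralProperties ℝ
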